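{- Let $K_4^-$ be the $3$-graph on $4$ vertices with exactly $3$ edges and $F_{3,2}$ the $3$-graph on $\{1,\dots,5\}$ with edges $123,124,125,345$. Then \[\pi_{K_4^- }(\{F_{3,2}\})=\frac{27}{64}.\]
   Context: A $3$-graph is a pair $G=(V,E)$ with $E$ a set of $3$-element subsets of $V$. For a $3$-graph $H$ on $h$ vertices and a $3$-graph $G$ on $n\ge h$ vertices, $e_H(G)$ is the number of $h$-subsets of $V(G)$ inducing a subgraph isomorphic to $H$. For a family $\mathcal{F}$ of $3$-graphs, $G$ is $\mathcal{F}$-free if it contains no member of $\mathcal{F}$ as a (not necessarily induced) subgraph. $\mathrm{ex}_H(n,\mathcal{F})$ is the maximum of $e_H(G)$ over $\mathcal{F}$-free $G$ on $n$ vertices, and $\pi_H(\mathcal{F})=\lim_{n\to\infty}\mathrm{ex}_H(n,\mathcal{F})/\binom{n}{h}$ (the limit exists). -}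

module Defs where

open import Data.Bool using (Bool; true; false; _∧_; _∨_; not; if_then_else_)
open import Data.Nat using (ℕ; zero; suc; _≡ᵇ_; _<ᵇ_; _⊔_)
open import Data.Product using (_×_; _,_)
open import Data.List using (List; []; _∷_; map; filter; length; concatMap; upTo; foldr; _++_)
open import Data.Bool.ListAction using (any; all)
open import Relation.Nullary.Decidable using (yes; no)
open import Data.Nat.Properties using (_≟_)

-- Conventions.  A 3-graph on n vertices has vertex set {0,…,n-1} and is given
-- by an edge list of triples (a , b , c) with a < b < c < n.  Every 3-graph on
-- [n] is represented by exactly one sublist of  triples n.

Triple : Set
Triple = ℕ × ℕ × ℕ

Graph : Set
Graph = List Triple

sublists : {A : Set} → List A → List (List A)
sublists []       = [] ∷ []
sublists (x ∷ xs) = let r = sublists xs in r ++ map (x ∷_) r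

kSubsets : ℕ → ℕ → List (List ℕ)
kSubsets k n = filter (λ s → length s ≟ k) (sublists (upTo n))

toTriple : List ℕ → Triple
toTriple (a ∷ b ∷ c ∷ _) = a , b , c
toTriple _               = 0 , 0 , 0

triples : ℕ → List Triple
triples n = map toTriple (kSubsets 3 n)

allGraphs : ℕ → List Graph
allGraphs n = sublists (triples n)

eqTᵇ : Triple → Triple → Bool
eqTᵇ (a , b , c) (x , y , z) = (a ≡ᵇ x) ∧ (b ≡ᵇ y) ∧ (c ≡ᵇ z)

memᵇ : Triple → Graph → Bool
memᵇ t G = any (eqTᵇ t) G

edgeᵇ : Graph → ℕ → ℕ → ℕ → Bool
edgeᵇ G a b c =
  memᵇ (a , b , c) G ∨ memᵇ (a , c , b) G ∨ memᵇ (b , a , c) G ∨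
  memᵇ (b , c , a) G ∨ memᵇ (c , a , b) G ∨ memᵇ (c , b , a) G

elemᵇ : ℕ → List ℕ → Bool
elemᵇ x xs = any (x ≡ᵇ_) xs

nth : List ℕ → ℕ → ℕ
nth []       _       = 0
nth (x ∷ _)  zero    = x
nth (_ ∷ xs) (suc i) = nth xs i

-- all injective maps {0,…,k-1} → {0,…,n-1}, as lists of k distinct values
-- (entry i of the list is the image of i)
injections : ℕ → ℕ → List (List ℕ)
injections zero    n = [] ∷ []
injections (suc k) n =
  concatMap (λ xs → map (λ v → xs ++ (v ∷ [])) (filter (λ v → Data.Bool._≟_ (elemᵇ v xs) false) (upTo n)))
            (injections k n)

containsᵇ : ℕ → Graph → ℕ → Graph → Bool
containsᵇ k F n G =
  any (λ φ → all (λ { (a , b , c) → edgeᵇ G (nth φ a) (nth φ b) (nth φ c) }) F)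
      (injections k n)

-- a family of 3-graphs: list of (number of vertices , edge list)
Family : Set
Family = List (ℕ × Graph)

freeᵇ : Family → ℕ → Graph → Bool
freeᵇ 𝓕 n G = not (any (λ { (k , F) → containsᵇ k F n G }) 𝓕)

inducesᵇ : ℕ → Graph → Graph → List ℕ → Bool
inducesᵇ h H G S =
  any (λ σ → all (λ { (a , b , c) →
         Data.Bool._≟_ (edgeᵇ H a b c) (edgeᵇ G (nth S (nth σ a)) (nth S (nth σ b)) (nth S (nth σ c))) |> λ { (yes _) → true ; (no _) → false } })
       (triples h))
      (injections h h)
  where
  _|>_ : {A B : Set} → A → (A → B) → B
  x |> f = f x

eH : ℕ → Graph → ℕ → Graph → ℕ
eH h H n G = length (filter (λ S → Data.Bool._≟_ (inducesᵇ h H G S) true) (kSubsets h n))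

exH : ℕ → Graph → Family → ℕ → ℕ
exH h H 𝓕 n = foldr _⊔_ 0 (map (eH h H n) (filter (λ G → Data.Bool._≟_ (freeᵇ 𝓕 n G) true) (allGraphs n)))

K4⁻ : Graph
K4⁻ = (0 , 1 , 2) ∷ (0 , 1 , 3) ∷ (0 , 2 , 3) ∷ []

-- F_{3,2} on {0,…,4} (paper's 1,…,5): edges 123,124,125,345
F32 : Graph
F32 = (0 , 1 , 2) ∷ (0 , 1 , 3) ∷ (0 , 1 , 4) ∷ (2 , 3 , 4) ∷ []

{-# OPTIONS --safe #-}

-- Lower bound: take as edges all triples with exactly one vertex in a set B of a
-- quarter of the vertices.  A copy 123, 124, 125, 345 of F₃,₂ is impossible, since
-- if 1 or 2 is in B then 3, 4, 5 are not, and otherwise 3, 4, 5 all are.  Every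
-- vertex of B spans a K₄⁻ with any three vertices outside B.
--
-- Upper bound: a sum-of-squares (flag algebra) argument on six points.  Let E be
-- the edge relation of an F₃,₂-free 3-graph.  For every 6-tuple of vertices, a
-- weighted count of the induced K₄⁻ it contains, plus terms q(p,s) q(p,t) for
-- disjoint pairs p, s, t and D(c) D(d) for edges uwz and further points c, d, is
-- at most a constant.  Summed over all 6-tuples, the extra terms become sums of
-- squares, so they are nonnegative and can be dropped, which leaves exactly 27/64.
-- Degenerate tuples need no separate treatment: blow-ups of an F₃,₂-free 3-graph are
-- F₃,₂-free, so the 6-point inequality holds for them as well.
--
-- The 6-point inequality only depends on which of the 20 triples are edges.  It is
-- invariant under permuting the points, so it suffices to evaluate it for patterns
-- that no adjacent transposition makes lexicographically larger; a search that
-- prunes copies of F₃,₂ and improvable prefixes leaves fewer than 2000 patterns.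
module Submission where

-- Sums over lists, over splittings of a list, and over tuples.

module Sums where
  open import Data.Nat as ℕ using (ℕ; zero; suc; _∸_; _!)
  import Data.Nat.Properties as ℕₚ
  open import Data.Nat.Combinatorics using (_C_; nCk+nC[k+1]≡[n+1]C[k+1]; k>n⇒nCk≡0)
  open import Data.Integer as ℤ using (ℤ; +_; _+_; _*_; _^_; 0ℤ; 1ℤ; _≤_)
  open import Data.Integer.Properties as ℤₚ using ()
  open import Data.Integer.Tactic.RingSolver using (solve-∀)
  open import Data.List using (List; []; _∷_; map; _++_; length)
  open import Data.List.Relation.Binary.Permutation.Propositional as P using (_↭_; ↭-refl; ↭-prep; ↭-swap)
  open import Data.List.Relation.Unary.All using (All; []; _∷_)
  open import Relation.Nullary using (yes; no)
  open import Relation.Binary.PropositionalEquality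

  private variable
    A B : Set

  +-congˡ : ∀ (a : ℤ) {b c} → b ≡ c → a + b ≡ a + c
  +-congˡ a = cong (λ b → a + b)

  ∑ : List A → (A → ℤ) → ℤ
  ∑ []       f = 0ℤ
  ∑ (x ∷ xs) f = f x + ∑ xs f

  ∑-cong : {f g : A → ℤ} (xs : List A) → (∀ x → f x ≡ g x) → ∑ xs f ≡ ∑ xs g
  ∑-cong []       h = refl
  ∑-cong (x ∷ xs) h = cong₂ _+_ (h x) (∑-cong xs h)

  interchange : ∀ a b c d → (a + b) + (c + d) ≡ (a + c) + (b + d)
  interchange = solve-∀

  ∑-+ : (f g : A → ℤ) (xs : List A) → ∑ xs (λ x → f x + g x) ≡ ∑ xs f + ∑ xs g
  ∑-+ f g []       = refl
  ∑-+ f g (x ∷ xs) = trans (+-congˡ (f x + g x) (∑-+ f g xs)) (interchange (f x) (g x) (∑ xs f) (∑ xs g))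

  ∑-*ˡ : (c : ℤ) (f : A → ℤ) (xs : List A) → ∑ xs (λ x → c * f x) ≡ c * ∑ xs f
  ∑-*ˡ c f []       = sym (ℤₚ.*-zeroʳ c)
  ∑-*ˡ c f (x ∷ xs) = trans (+-congˡ (c * f x) (∑-*ˡ c f xs)) (sym (ℤₚ.*-distribˡ-+ c (f x) (∑ xs f)))

  ∑-0 : (xs : List A) → ∑ xs (λ _ → 0ℤ) ≡ 0ℤ
  ∑-0 []       = refl
  ∑-0 (x ∷ xs) = trans (ℤₚ.+-identityˡ _) (∑-0 xs)

  ∑-swap : (f : A → B → ℤ) (xs : List A) (ys : List B) →
           ∑ xs (λ x → ∑ ys (f x)) ≡ ∑ ys (λ y → ∑ xs (λ x → f x y))
  ∑-swap f []       ys = sym (∑-0 ys)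
  ∑-swap f (x ∷ xs) ys = trans (+-congˡ (∑ ys (f x)) (∑-swap f xs ys)) (sym (∑-+ (f x) _ ys))

  ∑-mono : {f g : A → ℤ} (xs : List A) → (∀ x → f x ≤ g x) → ∑ xs f ≤ ∑ xs g
  ∑-mono []       h = ℤₚ.≤-refl
  ∑-mono (x ∷ xs) h = ℤₚ.+-mono-≤ (h x) (∑-mono xs h)

  ∑-↭ : (f : A → ℤ) {xs ys : List A} → xs ↭ ys → ∑ xs f ≡ ∑ ys f
  ∑-↭ f P.refl         = refl
  ∑-↭ f (P.prep x p)   = +-congˡ (f x) (∑-↭ f p)
  ∑-↭ f (P.swap x y p) = trans (cong (λ s → f x + (f y + s)) (∑-↭ f p)) (exchange (f x) (f y) _)
    where
    exchange : ∀ a b c → a + (b + c) ≡ b + (a + c)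
    exchange = solve-∀
  ∑-↭ f (P.trans p p′) = trans (∑-↭ f p) (∑-↭ f p′)

  ∑-map : (f : B → ℤ) (h : A → B) (xs : List A) → ∑ (map h xs) f ≡ ∑ xs (λ x → f (h x))
  ∑-map f h []       = refl
  ∑-map f h (x ∷ xs) = +-congˡ (f (h x)) (∑-map f h xs)

  ∑-++ : (f : A → ℤ) (xs ys : List A) → ∑ (xs ++ ys) f ≡ ∑ xs f + ∑ ys f
  ∑-++ f []       ys = sym (ℤₚ.+-identityˡ _)
  ∑-++ f (x ∷ xs) ys = trans (+-congˡ (f x) (∑-++ f xs ys)) (sym (ℤₚ.+-assoc (f x) _ _))

  -- choose k xs f is the sum of f l r over all splittings of xs into a sublist l of
  -- length k and the complementary sublist r.
  choose : ℕ → List A → (List A → List A → ℤ) → ℤ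
  choose zero    xs       f = f [] xs
  choose (suc k) []       f = 0ℤ
  choose (suc k) (x ∷ xs) f = choose k xs (λ l → f (x ∷ l)) + choose (suc k) xs (λ l r → f l (x ∷ r))

  choose-cong : {f g : List A → List A → ℤ} (k : ℕ) (xs : List A) →
                (∀ l r → f l r ≡ g l r) → choose k xs f ≡ choose k xs g
  choose-cong zero    xs       h = h [] xs
  choose-cong (suc k) []       h = refl
  choose-cong (suc k) (x ∷ xs) h = cong₂ _+_ (choose-cong k xs λ l r → h (x ∷ l) r) (choose-cong (suc k) xs λ l r → h l (x ∷ r))

  choose-map : (h : A → B) (f : List B → List B → ℤ) (k : ℕ) (xs : List A) →
               choose k (map h xs) f ≡ choose k xs (λ l r → f (map h l) (map h r))
  choose-map h f zero    xs       = refl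
  choose-map h f (suc k) []       = refl
  choose-map h f (suc k) (x ∷ xs) = cong₂ _+_ (choose-map h _ k xs) (choose-map h _ (suc k) xs)

  Invariant : {C : Set} → (List A → C) → Set
  Invariant f = ∀ {l l′} → l ↭ l′ → f l ≡ f l′

  Invariant₂ : (List A → List A → ℤ) → Set
  Invariant₂ f = ∀ {l l′ r r′} → l ↭ l′ → r ↭ r′ → f l r ≡ f l′ r′

  -- In the swap case the splittings fall into four groups, by the sides on which `x` and `y` land,
  -- and `interchange` trades the two mixed groups. For sublists of length one the group with both
  -- on the left is absent, hence the separate clause.
  choose-↭ : (k : ℕ) {f : List A → List A → ℤ} → Invariant₂ f → Invariant (λ xs → choose k xs f)
  choose-↭ zero    h p = h ↭-refl p
  choose-↭ (suc k) h P.refl = refl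
  choose-↭ (suc k) h (P.prep x p) =
    cong₂ _+_ (choose-↭ k (λ p → h (↭-prep x p)) p) (choose-↭ (suc k) (λ p q → h p (↭-prep x q)) p)
  choose-↭ (suc zero) {f} h (P.swap {xs} {ys} x y p) =
    trans (exchange (f (x ∷ []) (y ∷ xs)) (f (y ∷ []) (x ∷ xs)) _)
      (cong₂ _+_ (h ↭-refl (↭-prep x p)) (cong₂ _+_ (h ↭-refl (↭-prep y p))
        (trans (choose-↭ 1 (λ p q → h p (↭-prep x (↭-prep y q))) p)
               (choose-cong 1 ys λ l r → h ↭-refl (↭-swap x y ↭-refl)))))
    where
    exchange : ∀ a b c → a + (b + c) ≡ b + (a + c)
    exchange = solve-∀
  choose-↭ (suc (suc k)) {f} h (P.swap {xs} {ys} x y p) =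
    trans (cong₂ _+_ (cong₂ _+_ (trans (choose-↭ k (λ p → h (↭-prep x (↭-prep y p))) p)
                                       (choose-cong k ys λ l r → h (↭-swap x y ↭-refl) ↭-refl))
                                (choose-↭ (suc k) (λ p q → h (↭-prep x p) (↭-prep y q)) p))
                     (cong₂ _+_ (choose-↭ (suc k) (λ p q → h (↭-prep y p) (↭-prep x q)) p)
                                (trans (choose-↭ (suc (suc k)) (λ p q → h p (↭-prep x (↭-prep y q))) p)
                                       (choose-cong (suc (suc k)) ys λ l r → h ↭-refl (↭-swap x y ↭-refl)))))
          (interchange (choose k ys λ l → f (y ∷ x ∷ l)) _ _ _)
  choose-↭ (suc k) h (P.trans p p′) = trans (choose-↭ (suc k) h p) (choose-↭ (suc k) h p′)

  -- Sums over all k-tuples with entries drawn independently from a list.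

  tsum : List A → (k : ℕ) → (List A → ℤ) → ℤ
  tsum V zero    f = f []
  tsum V (suc k) f = ∑ V λ x → tsum V k λ l → f (x ∷ l)

  module _ (V : List A) where

    tsum-cong : {f g : List A → ℤ} (k : ℕ) → (∀ l → f l ≡ g l) → tsum V k f ≡ tsum V k g
    tsum-cong zero    h = h []
    tsum-cong (suc k) h = ∑-cong V λ x → tsum-cong k λ l → h (x ∷ l)

    tsum-+ : (k : ℕ) (f g : List A → ℤ) → tsum V k (λ l → f l + g l) ≡ tsum V k f + tsum V k g
    tsum-+ zero    f g = refl
    tsum-+ (suc k) f g = trans (∑-cong V λ x → tsum-+ k (λ l → f (x ∷ l)) (λ l → g (x ∷ l))) (∑-+ _ _ V)

    tsum-*ˡ : (k : ℕ) (c : ℤ) (f : List A → ℤ) → tsum V k (λ l → c * f l) ≡ c * tsum V k f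
    tsum-*ˡ zero    c f = refl
    tsum-*ˡ (suc k) c f = trans (∑-cong V λ x → tsum-*ˡ k c (λ l → f (x ∷ l))) (∑-*ˡ c _ V)

    tsum-*ʳ : (k : ℕ) (c : ℤ) (f : List A → ℤ) → tsum V k (λ l → f l * c) ≡ tsum V k f * c
    tsum-*ʳ k c f = trans (tsum-cong k λ l → ℤₚ.*-comm (f l) c)
                          (trans (tsum-*ˡ k c f) (ℤₚ.*-comm c _))

    tsum-0 : (k : ℕ) → tsum V k (λ _ → 0ℤ) ≡ 0ℤ
    tsum-0 k = trans (tsum-*ˡ k 0ℤ (λ _ → 0ℤ)) (ℤₚ.*-zeroˡ (tsum V k (λ _ → 0ℤ)))

    tsum-mono : (k : ℕ) {f g : List A → ℤ} → (∀ l → length l ≡ k → f l ≤ g l) → tsum V k f ≤ tsum V k g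
    tsum-mono zero    h = h [] refl
    tsum-mono (suc k) h = ∑-mono V λ x → tsum-mono k λ l e → h (x ∷ l) (cong suc e)

    tsum-nonneg : (k : ℕ) {f : List A → ℤ} → (∀ l → 0ℤ ≤ f l) → 0ℤ ≤ tsum V k f
    tsum-nonneg k h = subst (λ z → z ≤ tsum V k _) (tsum-0 k) (tsum-mono k λ l _ → h l)

    ∑-const : (xs : List A) (c : ℤ) → ∑ xs (λ _ → c) ≡ + length xs * c
    ∑-const []       c = sym (ℤₚ.*-zeroˡ c)
    ∑-const (x ∷ xs) c = trans (+-congˡ c (∑-const xs c)) (sym (ℤₚ.suc-* (+ length xs) c))

    tsum-const : (k : ℕ) (c : ℤ) → tsum V k (λ _ → c) ≡ (+ length V) ^ k * c
    tsum-const zero    c = sym (ℤₚ.*-identityˡ c)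
    tsum-const (suc k) c = trans (∑-cong V λ _ → tsum-const k c)
      (trans (∑-const V _) (sym (ℤₚ.*-assoc (+ length V) _ c)))

    ∑-tsum : (f : B → List A → ℤ) (xs : List B) (k : ℕ) →
             ∑ xs (λ x → tsum V k (f x)) ≡ tsum V k (λ l → ∑ xs λ x → f x l)
    ∑-tsum f xs zero    = refl
    ∑-tsum f xs (suc k) = trans (∑-swap _ xs V) (∑-cong V λ y → ∑-tsum (λ x l → f x (y ∷ l)) xs k)

    tsum-square : (k : ℕ) (f : List A → ℤ) →
                  tsum V k (λ l → tsum V k (λ r → f l * f r)) ≡ tsum V k f * tsum V k f
    tsum-square k f = trans (tsum-cong k λ l → tsum-*ˡ k (f l) f) (tsum-*ʳ k _ f)

    -- The coordinates range independently over `V`, so every k-set of positions contributes the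
    -- same amount. Splitting on whether the first position is chosen gives Pascal's rule.
    tsum-choose : (n k : ℕ) (f : List A → List A → ℤ) →
                  tsum V n (λ v → choose k v f) ≡ + (n C k) * tsum V k (λ l → tsum V (n ∸ k) (f l))
    tsum-choose zero    zero    f = sym (ℤₚ.*-identityˡ _)
    tsum-choose (suc n) zero    f = sym (ℤₚ.*-identityˡ _)
    tsum-choose zero    (suc k) f = sym (ℤₚ.*-zeroˡ (tsum V (suc k) (λ l → f l [])))
    tsum-choose (suc n) (suc k) f = begin
        ∑ V (λ x → tsum V n (λ v → choose k v (λ l → f (x ∷ l)) + choose (suc k) v (λ l r → f l (x ∷ r))))
      ≡⟨ trans (∑-cong V λ x → tsum-+ n _ _) (∑-+ _ _ V) ⟩
        ∑ V (λ x → tsum V n (λ v → choose k v (λ l → f (x ∷ l)))) +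
        ∑ V (λ x → tsum V n (λ v → choose (suc k) v (λ l r → f l (x ∷ r))))
      ≡⟨ cong₂ _+_ (trans (∑-cong V λ x → tsum-choose n k (λ l → f (x ∷ l))) (∑-*ˡ (+ (n C k)) _ V)) second ⟩
        + (n C k) * S + + (n C suc k) * S
      ≡⟨ sym (ℤₚ.*-distribʳ-+ S (+ (n C k)) (+ (n C suc k))) ⟩
        + (n C k ℕ.+ n C suc k) * S
      ≡⟨ cong (λ m → + m * S) (nCk+nC[k+1]≡[n+1]C[k+1] n k) ⟩
        + (suc n C suc k) * S ∎
      where
      open ≡-Reasoning
      S = tsum V (suc k) (λ l → tsum V (n ∸ k) (f l))
      -- `n ∸ k` is the successor of `n ∸ suc k` only if `suc k ≤ n`; otherwise the binomial
      -- coefficient is zero on both sides.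
      second : ∑ V (λ x → tsum V n (λ v → choose (suc k) v (λ l r → f l (x ∷ r)))) ≡ + (n C suc k) * S
      second with suc k ℕ.≤? n
      ... | yes k<n = begin
          ∑ V (λ x → tsum V n (λ v → choose (suc k) v (λ l r → f l (x ∷ r))))
        ≡⟨ trans (∑-cong V λ x → tsum-choose n (suc k) (λ l r → f l (x ∷ r))) (∑-*ˡ (+ (n C suc k)) _ V) ⟩
          + (n C suc k) * ∑ V (λ x → tsum V (suc k) (λ l → tsum V (n ∸ suc k) (λ r → f l (x ∷ r))))
        ≡⟨ cong (+ (n C suc k) *_) (∑-tsum (λ x l → tsum V (n ∸ suc k) (λ r → f l (x ∷ r))) V (suc k)) ⟩
          + (n C suc k) * tsum V (suc k) (λ l → tsum V (suc (n ∸ suc k)) (f l))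
        ≡⟨ cong (λ m → + (n C suc k) * tsum V (suc k) (λ l → tsum V m (f l))) (sym (ℕₚ.+-∸-assoc 1 k<n)) ⟩
          + (n C suc k) * S ∎
      ... | no k≮n = trans
        (trans (∑-cong V λ x → trans (tsum-choose n (suc k) (λ l r → f l (x ∷ r)))
                                     (cong (λ m → + m * tsum V (suc k) (λ l → tsum V (n ∸ suc k) (λ r → f l (x ∷ r)))) none))
               (∑-0 V))
        (cong (λ m → + m * S) (sym none))
        where
        none : n C suc k ≡ 0
        none = k>n⇒nCk≡0 (ℕₚ.≰⇒> k≮n)

  -- Tuples that avoid the new entry `y` give the first term. Those with `y` in exactly one of the
  -- `suc k` positions give the second, by invariance. All others are dropped by nonnegativity.
  tsum-insert : (y : A) (ys : List A) (k : ℕ) {f : List A → ℤ} → (∀ l → 0ℤ ≤ f l) → Invariant f →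
                tsum ys (suc k) f + + suc k * tsum ys k (λ l → f (y ∷ l)) ≤ tsum (y ∷ ys) (suc k) f
  tsum-insert y ys zero {f} pos inv = ℤₚ.≤-reflexive (lemma (∑ ys (λ x → f (x ∷ []))) (f (y ∷ [])))
    where
    lemma : ∀ a b → a + 1ℤ * b ≡ b + a
    lemma = solve-∀
  tsum-insert y ys (suc k) {f} pos inv = begin
      T + + suc (suc k) * U
    ≡⟨ trans (cong (λ c → T + c * U) (ℤₚ.pos-+ 1 (suc k))) (lemma T U (+ suc k)) ⟩
      U + (T + + suc k * U)
    ≤⟨ ℤₚ.+-mono-≤ first second ⟩
      tsum (y ∷ ys) (suc (suc k)) f ∎
    where
    open ℤₚ.≤-Reasoning
    T = tsum ys (suc (suc k)) f
    U = tsum ys (suc k) (λ l → f (y ∷ l))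
    lemma : ∀ a b c → a + (1ℤ + c) * b ≡ b + (a + c * b)
    lemma = solve-∀
    first : U ≤ tsum (y ∷ ys) (suc k) (λ l → f (y ∷ l))
    first = ℤₚ.≤-trans
      (ℤₚ.i≤i+j U (+ suc k * tsum ys k (λ l → f (y ∷ y ∷ l)))
        {{ℤ.nonNegative (subst (λ z → z ≤ + suc k * tsum ys k (λ l → f (y ∷ y ∷ l))) (ℤₚ.*-zeroʳ (+ suc k))
            (ℤₚ.*-monoˡ-≤-nonNeg (+ suc k) (tsum-nonneg ys k λ l → pos (y ∷ y ∷ l))))}})
      (tsum-insert y ys k (λ l → pos (y ∷ l)) (λ p → inv (↭-prep y p)))
    second : T + + suc k * U ≤ ∑ ys (λ x → tsum (y ∷ ys) (suc k) (λ l → f (x ∷ l)))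
    second = begin
        T + + suc k * U
      ≡⟨ cong (λ u → T + + suc k * u) (∑-cong ys λ x → tsum-cong ys k λ l → inv (↭-swap y x ↭-refl)) ⟩
        T + + suc k * ∑ ys (λ x → tsum ys k (λ l → f (x ∷ y ∷ l)))
      ≡⟨ trans (+-congˡ T (sym (∑-*ˡ (+ suc k) (λ x → tsum ys k (λ l → f (x ∷ y ∷ l))) ys)))
             (sym (∑-+ (λ x → tsum ys (suc k) (λ l → f (x ∷ l))) _ ys)) ⟩
        ∑ ys (λ x → tsum ys (suc k) (λ l → f (x ∷ l)) + + suc k * tsum ys k (λ l → f (x ∷ y ∷ l)))
      ≤⟨ ∑-mono ys (λ x → tsum-insert y ys k (λ l → pos (x ∷ l)) (λ p → inv (↭-prep x p))) ⟩
        ∑ ys (λ x → tsum (y ∷ ys) (suc k) (λ l → f (x ∷ l))) ∎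

  -- A k-sublist occurs among the k-tuples in all its k! orders, and tuples that repeat a position
  -- only add nonnegative terms.
  factorial-choose≤tsum : (xs : List A) (k : ℕ) {f : List A → ℤ} → (∀ l → 0ℤ ≤ f l) → Invariant f →
                          + (k !) * choose k xs (λ l _ → f l) ≤ tsum xs k f
  factorial-choose≤tsum xs       zero    {f} pos inv = ℤₚ.≤-reflexive (ℤₚ.*-identityˡ (f []))
  factorial-choose≤tsum []       (suc k) {f} pos inv = ℤₚ.≤-reflexive (ℤₚ.*-zeroʳ (+ (suc k !)))
  factorial-choose≤tsum (y ∷ ys) (suc k) {f} pos inv = begin
      + (suc k !) * (X + Y)
    ≡⟨ trans (ℤₚ.*-distribˡ-+ (+ (suc k !)) X Y) (ℤₚ.+-comm (+ (suc k !) * X) _) ⟩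
      + (suc k !) * Y + + (suc k !) * X
    ≡⟨ cong (λ c → + (suc k !) * Y + c) (trans (cong (_* X) (ℤₚ.pos-* (suc k) (k !))) (ℤₚ.*-assoc (+ suc k) (+ (k !)) X)) ⟩
      + (suc k !) * Y + + suc k * (+ (k !) * X)
    ≤⟨ ℤₚ.+-mono-≤ (factorial-choose≤tsum ys (suc k) pos inv)
         (ℤₚ.*-monoˡ-≤-nonNeg (+ suc k) (factorial-choose≤tsum ys k (λ l → pos (y ∷ l)) (λ p → inv (↭-prep y p)))) ⟩
      tsum ys (suc k) f + + suc k * tsum ys k (λ l → f (y ∷ l))
    ≤⟨ tsum-insert y ys k pos inv ⟩
      tsum (y ∷ ys) (suc k) f ∎
    where
    open ℤₚ.≤-Reasoning
    X = choose k ys (λ l _ → f (y ∷ l))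
    Y = choose (suc k) ys (λ l _ → f l)

-- The six-point functional and its average over 6-tuples.

module Certificate where
  open Sums
  open import Data.Bool using (Bool; true; false; if_then_else_)
  open import Data.Nat as ℕ using (ℕ; zero; suc)
  open import Data.Integer as ℤ using (ℤ; +_; -_; _+_; _-_; _*_; _^_; 0ℤ; 1ℤ; _≤_)
  open import Data.Integer.Properties as ℤₚ using ()
  open import Data.Integer.Tactic.RingSolver using (solve-∀)
  open import Data.List using (List; []; _∷_; map; _++_; length)
  open import Data.List.Properties using (map-++)
  open import Data.List.Relation.Binary.Permutation.Propositional as P using (_↭_; ↭-refl; ↭-prep)
  open import Data.List.Relation.Binary.Permutation.Propositional.Properties using (++⁺)
  open import Relation.Binary.PropositionalEquality

  private variable
    A B C : Set

  -- Adjacent transpositions suffice, and for functions that are constant outside short lists these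
  -- amount to a handful of cases.
  invariant : {f : List A → C} → (∀ us x y vs → f (us ++ x ∷ y ∷ vs) ≡ f (us ++ y ∷ x ∷ vs)) → Invariant f
  invariant h P.refl = refl
  invariant h (P.prep x p) = invariant (λ us → h (x ∷ us)) p
  invariant h (P.swap x y p) = trans (h [] x y _) (invariant (λ us → h (y ∷ x ∷ us)) p)
  invariant h (P.trans p p′) = trans (invariant h p) (invariant h p′)

  ⟦_⟧ : Bool → ℤ
  ⟦ true  ⟧ = 1ℤ
  ⟦ false ⟧ = 0ℤ

  -- q p s below is Q i j, where i counts the edges p ∪ {x} with x ∈ s and j the
  -- edges {x} ∪ s with x ∈ p.  The table makes the mean of q p over random pairs s
  -- vanish for every p in the extremal configuration, whose edges are the triples
  -- with exactly one vertex in a quarter of the vertices; the remaining freedom was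
  -- found by semidefinite programming.
  Q : ℤ → ℤ → ℤ
  Q (+ 0) (+ 0) = + 279
  Q (+ 0) (+ 2) = - + 217
  Q (+ 1) (+ 1) = - + 57
  Q (+ 1) (+ 2) = - + 245
  Q (+ 2) (+ 0) = - + 1041
  Q (+ 2) (+ 1) = + 7
  Q _     _     = 0ℤ

  isThree : ℤ → ℤ
  isThree (+ 3) = 1ℤ
  isThree _     = 0ℤ

  onlyIf : Bool → ℤ → ℤ
  onlyIf b x = if b then x else 0ℤ

  pairProduct : (A → ℤ) → List A → ℤ
  pairProduct g (c ∷ d ∷ []) = g c * g d
  pairProduct g _            = 0ℤ

  pairProduct-cong : {f g : A → ℤ} → (∀ x → f x ≡ g x) → ∀ l → pairProduct f l ≡ pairProduct g l
  pairProduct-cong h []              = refl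
  pairProduct-cong h (_ ∷ [])        = refl
  pairProduct-cong h (c ∷ d ∷ [])    = cong₂ _*_ (h c) (h d)
  pairProduct-cong h (_ ∷ _ ∷ _ ∷ _) = refl

  pairProduct-map : (g : B → ℤ) (h : A → B) → ∀ l → pairProduct g (map h l) ≡ pairProduct (λ x → g (h x)) l
  pairProduct-map g h []              = refl
  pairProduct-map g h (_ ∷ [])        = refl
  pairProduct-map g h (_ ∷ _ ∷ [])    = refl
  pairProduct-map g h (_ ∷ _ ∷ _ ∷ _) = refl

  pairProduct-↭ : (g : A → ℤ) → Invariant (pairProduct g)
  pairProduct-↭ g = invariant λ where
    []              x y []      → ℤₚ.*-comm (g x) (g y)
    []              x y (_ ∷ _) → refl
    (_ ∷ [])        x y vs      → refl
    (_ ∷ _ ∷ [])    x y vs      → refl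
    (_ ∷ _ ∷ _ ∷ _) x y vs      → refl

  module Pattern {A : Set} (E : A → A → A → Bool) where

    isEdge : List A → Bool
    isEdge (x ∷ y ∷ z ∷ []) = E x y z
    isEdge _                = false

    edge : List A → ℤ
    edge l = ⟦ isEdge l ⟧

    -- Up to isomorphism K₄⁻ is the only 3-graph on four vertices with three edges, so an induced
    -- copy is recognised by counting edges.
    K : List A → ℤ
    K s = isThree (choose 3 s λ t _ → edge t)

    q : List A → List A → ℤ
    q p r = Q (∑ r λ x → edge (x ∷ p)) (∑ p λ x → edge (x ∷ r))

    -- For an edge uwz of the extremal configuration, the mean of D over random c is
    -- a multiple of 3 · 1/4 − 1 · 3/4 = 0.
    D : List A → List A → A → ℤ
    D (u ∷ w ∷ []) (z ∷ []) c = (⟦ E c w z ⟧ - ⟦ E c u z ⟧) * (if E c u w then 1ℤ else + 3)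
    D _            _        _ = 0ℤ

    -- Summed over all 4-tuples `r`, the first part becomes a multiple of the square of the sum of
    -- `q p`. In the second part each `z` that completes `p` to an edge contributes a multiple of
    -- the square of the sum of `D p z`.
    pairTerm : ℤ → List A → List A → ℤ
    pairTerm b p r =
      choose 2 r (λ s t → q p s * q p t) +
      b * choose 1 r (λ z s → onlyIf (isEdge (p ++ z)) (choose 2 s λ cd _ → pairProduct (D p z) cd))

    total : ℤ → ℤ → List A → ℤ
    total a b v = a * choose 4 v (λ s _ → K s) + choose 2 v (pairTerm b)

  -- Invariance of the functional under permutations of the points.

  module _ {A : Set} {E : A → A → A → Bool}
           (sym₁₂ : ∀ x y z → E x y z ≡ E y x z) (sym₂₃ : ∀ x y z → E x y z ≡ E x z y) where
    open Pattern E

    isEdge-↭ : Invariant isEdge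
    isEdge-↭ = invariant λ where
      []              x y []            → refl
      []              x y (z ∷ [])      → sym₁₂ x y z
      []              x y (_ ∷ _ ∷ _)   → refl
      (a ∷ [])        x y []            → sym₂₃ a x y
      (_ ∷ [])        x y (_ ∷ _)       → refl
      (_ ∷ _ ∷ [])    x y vs            → refl
      (_ ∷ _ ∷ _ ∷ []) x y vs           → refl
      (_ ∷ _ ∷ _ ∷ _ ∷ _) x y vs        → refl

    edge-↭ : Invariant edge
    edge-↭ p = cong ⟦_⟧ (isEdge-↭ p)

    K-↭ : Invariant K
    K-↭ p = cong isThree (choose-↭ 3 (λ p _ → edge-↭ p) p)

    q-↭ : Invariant₂ q
    q-↭ {p} {p′} {r} {r′} e e′ = cong₂ Q
      (trans (∑-cong r λ x → edge-↭ (↭-prep x e)) (∑-↭ _ e′))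
      (trans (∑-cong p λ x → edge-↭ (↭-prep x e′)) (∑-↭ _ e))

    D-long : ∀ p {x y vs} c → D p (x ∷ y ∷ vs) c ≡ 0ℤ
    D-long []              c = refl
    D-long (_ ∷ [])        c = refl
    D-long (_ ∷ _ ∷ [])    c = refl
    D-long (_ ∷ _ ∷ _ ∷ _) c = refl

    D-↭ʳ : ∀ p {z z′} → z ↭ z′ → ∀ c → D p z c ≡ D p z′ c
    D-↭ʳ p e c = invariant {f = λ z → D p z c} (λ where
      []           x y vs → trans (D-long p c) (sym (D-long p c))
      (_ ∷ [])     x y vs → trans (D-long p c) (sym (D-long p c))
      (_ ∷ _ ∷ _)  x y vs → trans (D-long p c) (sym (D-long p c))) e

    -- Reordering the pair only changes the sign of `D`, which cancels in a product of two values;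
    -- this makes `pairTerm` a function of the unordered pair.
    D-antisym : ∀ u w z c → D (u ∷ w ∷ []) z c ≡ - D (w ∷ u ∷ []) z c
    D-antisym u w []          c = refl
    D-antisym u w (z ∷ [])    c =
      trans (cong (λ b → (⟦ E c w z ⟧ - ⟦ E c u z ⟧) * (if b then 1ℤ else + 3)) (sym₂₃ c u w))
            (flip ⟦ E c w z ⟧ ⟦ E c u z ⟧ _)
      where
      flip : ∀ a b k → (a - b) * k ≡ - ((b - a) * k)
      flip = solve-∀
    D-antisym u w (_ ∷ _ ∷ _) c = refl

    pairProduct-D-↭ : ∀ z cd → Invariant (λ p → pairProduct (D p z) cd)
    pairProduct-D-↭ z cd = invariant λ where
        []              x y []      → swapped x y cd
        []              x y (_ ∷ _) → refl
        (_ ∷ [])        x y vs      → refl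
        (_ ∷ _ ∷ [])    x y vs      → refl
        (_ ∷ _ ∷ _ ∷ _) x y vs      → refl
      where
      neg² : ∀ a b → (- a) * (- b) ≡ a * b
      neg² = solve-∀
      swapped : ∀ x y cd → pairProduct (D (x ∷ y ∷ []) z) cd ≡ pairProduct (D (y ∷ x ∷ []) z) cd
      swapped x y []              = refl
      swapped x y (_ ∷ [])        = refl
      swapped x y (c ∷ d ∷ [])    =
        trans (cong₂ _*_ (D-antisym x y z c) (D-antisym x y z d)) (neg² (D (y ∷ x ∷ []) z c) _)
      swapped x y (_ ∷ _ ∷ _ ∷ _) = refl

    pairTerm-↭ : ∀ b → Invariant₂ (pairTerm b)
    pairTerm-↭ b {p} {p′} {r} {r′} e e′ = cong₂ _+_
        (trans (choose-cong 2 r λ s t → cong₂ _*_ (qˡ s) (qˡ t))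
               (choose-↭ 2 (λ es et → cong₂ _*_ (qʳ es) (qʳ et)) e′))
        (cong (λ c → b * c)
          (trans (choose-cong 1 r λ z s → cong₂ onlyIf (isEdge-↭ (++⁺ e (↭-refl {x = z})))
                    (choose-cong 2 s λ cd _ → pairProduct-D-↭ z cd e))
                 (choose-↭ 1 (λ {z} {z′} {s} ez es → cong₂ onlyIf (isEdge-↭ (++⁺ (↭-refl {x = p′}) ez))
                     (trans (choose-cong 2 s λ cd _ → pairProduct-cong (D-↭ʳ p′ ez) cd)
                            (choose-↭ 2 (λ ec _ → pairProduct-↭ (D p′ z′) ec) es))) e′)))
      where
      qˡ : ∀ s → q p s ≡ q p′ s
      qˡ s = q-↭ {p} {p′} {s} {s} e ↭-refl
      qʳ : ∀ {s s′} → s ↭ s′ → q p′ s ≡ q p′ s′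
      qʳ = q-↭ {p′} {p′} ↭-refl

    total-↭ : ∀ a b → Invariant (total a b)
    total-↭ a b e = cong₂ (λ x y → a * x + y) (choose-↭ 4 (λ p _ → K-↭ p) e) (choose-↭ 2 (pairTerm-↭ b) e)

  -- Transport of the functional along a map of points.

  module _ {A B : Set} {E : B → B → B → Bool} {E′ : A → A → A → Bool} (h : A → B)
           (E≗E′ : ∀ x y z → E (h x) (h y) (h z) ≡ E′ x y z) where
    private
      module M = Pattern E
      module M′ = Pattern E′

    isEdge-map : ∀ l → M.isEdge (map h l) ≡ M′.isEdge l
    isEdge-map []                  = refl
    isEdge-map (_ ∷ [])            = refl
    isEdge-map (_ ∷ _ ∷ [])        = refl
    isEdge-map (x ∷ y ∷ z ∷ [])    = E≗E′ x y z
    isEdge-map (_ ∷ _ ∷ _ ∷ _ ∷ _) = refl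

    edge-map : ∀ l → M.edge (map h l) ≡ M′.edge l
    edge-map l = cong ⟦_⟧ (isEdge-map l)

    K-map : ∀ s → M.K (map h s) ≡ M′.K s
    K-map s = cong isThree (trans (choose-map h _ 3 s) (choose-cong 3 s λ t _ → edge-map t))

    q-map : ∀ p r → M.q (map h p) (map h r) ≡ M′.q p r
    q-map p r = cong₂ Q (trans (∑-map _ h r) (∑-cong r λ x → edge-map (x ∷ p)))
                        (trans (∑-map _ h p) (∑-cong p λ x → edge-map (x ∷ r)))

    D-map : ∀ p z c → M.D (map h p) (map h z) (h c) ≡ M′.D p z c
    D-map []              z           c = refl
    D-map (_ ∷ [])        z           c = refl
    D-map (_ ∷ _ ∷ _ ∷ _) z           c = refl
    D-map (_ ∷ _ ∷ [])    []          c = refl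
    D-map (_ ∷ _ ∷ [])    (_ ∷ _ ∷ _) c = refl
    D-map (u ∷ w ∷ [])    (z ∷ [])    c
      rewrite E≗E′ c w z | E≗E′ c u z | E≗E′ c u w = refl

    pairTerm-map : ∀ b p r → M.pairTerm b (map h p) (map h r) ≡ M′.pairTerm b p r
    pairTerm-map b p r = cong₂ (λ x y → x + b * y)
      (trans (choose-map h _ 2 r) (choose-cong 2 r λ s t → cong₂ _*_ (q-map p s) (q-map p t)))
      (trans (choose-map h _ 1 r) (choose-cong 1 r λ z s → cong₂ onlyIf
        (trans (cong M.isEdge (sym (map-++ h p z))) (isEdge-map (p ++ z)))
        (trans (choose-map h _ 2 s) (choose-cong 2 s λ cd _ →
          trans (pairProduct-map (M.D (map h p) (map h z)) h cd) (pairProduct-cong (D-map p z) cd)))))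

    total-map : ∀ a b v → M.total a b (map h v) ≡ M′.total a b v
    total-map a b v = cong₂ (λ x y → a * x + y)
      (trans (choose-map h _ 4 v) (choose-cong 4 v λ s _ → K-map s))
      (trans (choose-map h _ 2 v) (choose-cong 2 v (pairTerm-map b)))

  -- Averaging: the square terms are nonnegative.

  module _ {A : Set} (E : A → A → A → Bool) (V : List A) where
    open Pattern E

    0≤n*i : ∀ n {i} → 0ℤ ≤ i → 0ℤ ≤ + n * i
    0≤n*i n {i} p = subst (λ z → z ≤ + n * i) (ℤₚ.*-zeroʳ (+ n)) (ℤₚ.*-monoˡ-≤-nonNeg (+ n) p)

    0≤i² : ∀ i → 0ℤ ≤ i * i
    0≤i² (+ zero)     = ℤ.+≤+ ℕ.z≤n
    0≤i² (+ suc n)    = ℤ.+≤+ ℕ.z≤n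
    0≤i² (ℤ.-[1+ n ]) = ℤ.+≤+ ℕ.z≤n

    onlyIf-nonneg : ∀ b {x} → 0ℤ ≤ x → 0ℤ ≤ onlyIf b x
    onlyIf-nonneg true  p = p
    onlyIf-nonneg false p = ℤₚ.≤-refl

    tsum-onlyIf : ∀ k b f → tsum V k (λ l → onlyIf b (f l)) ≡ onlyIf b (tsum V k f)
    tsum-onlyIf k true  f = refl
    tsum-onlyIf k false f = tsum-0 V k

    -- Independence of the coordinates turns sums of products over disjoint positions into squares.
    -- The factors are 6 = C(4,2) for `s` and `t`, 4 = C(4,1) for `z`, and 3 = C(3,2) for the pair
    -- `cd`.
    tsum-pairTerm-nonneg : ∀ b p → 0ℤ ≤ tsum V 4 (pairTerm (+ b) p)
    tsum-pairTerm-nonneg b p = subst (λ z → 0ℤ ≤ z) (sym expand) (ℤₚ.+-mono-≤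
        (0≤n*i 6 (0≤i² (tsum V 2 (q p))))
        (0≤n*i b (0≤n*i 4 (tsum-nonneg V 1 λ z → onlyIf-nonneg (isEdge (p ++ z))
          (0≤n*i 3 (0≤n*i (length V) (0≤i² (∑ V (D p z)))))))))
      where
      qq : List A → List A → ℤ
      qq s t = q p s * q p t
      DD : List A → List A → ℤ
      DD z s = choose 2 s λ cd _ → pairProduct (D p z) cd
      eDD : List A → List A → ℤ
      eDD z s = onlyIf (isEdge (p ++ z)) (DD z s)
      -- One of the three points of `s` lies outside the chosen pair; summing over it gives the
      -- factor `length V`.
      inner : ∀ z → tsum V 3 (DD z) ≡ + 3 * (+ length V * (∑ V (D p z) * ∑ V (D p z)))
      inner z = trans (tsum-choose V 3 2 (λ cd _ → pairProduct (D p z) cd)) (cong (λ c → + 3 * c)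
        (trans (tsum-cong V 2 λ cd → ∑-const V V (pairProduct (D p z) cd))
        (trans (tsum-*ˡ V 2 (+ length V) (pairProduct (D p z))) (cong (λ c → + length V * c)
        (trans (∑-cong V λ c → ∑-*ˡ (D p z c) (D p z) V)
               (tsum-*ʳ V 1 (∑ V (D p z)) (λ { (c ∷ _) → D p z c ; [] → 0ℤ })))))))
      expand : tsum V 4 (pairTerm (+ b) p) ≡ + 6 * (tsum V 2 (q p) * tsum V 2 (q p)) +
               + b * (+ 4 * tsum V 1 (λ z → onlyIf (isEdge (p ++ z)) (+ 3 * (+ length V * (∑ V (D p z) * ∑ V (D p z))))))
      expand = trans (tsum-+ V 4 (λ r → choose 2 r qq) (λ r → + b * choose 1 r eDD)) (cong₂ _+_
        (trans (tsum-choose V 4 2 qq) (cong (λ c → + 6 * c) (tsum-square V 2 (q p))))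
        (trans (tsum-*ˡ V 4 (+ b) (λ r → choose 1 r eDD)) (cong (λ e → + b * e)
          (trans (tsum-choose V 4 1 eDD) (cong (λ c → + 4 * c)
            (tsum-cong V 1 λ z → trans (tsum-onlyIf 3 (isEdge (p ++ z)) (DD z)) (cong (onlyIf (isEdge (p ++ z))) (inner z))))))))

    private
      n : ℤ
      n = + length V

    -- 15 is both C(6,4) and C(6,2), and the two points outside a 4-set account for `n * n`.
    tsum-total : ∀ a b → tsum V 6 (total a b) ≡
                 a * (+ 15 * (n * n * tsum V 4 K)) + + 15 * tsum V 2 (λ p → tsum V 4 (pairTerm b p))
    tsum-total a b = trans (tsum-+ V 6 (λ v → a * choose 4 v (λ s _ → K s)) (λ v → choose 2 v (pairTerm b))) (cong₂ _+_
        (trans (tsum-*ˡ V 6 a (λ v → choose 4 v (λ s _ → K s))) (cong (λ c → a * c)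
          (trans (tsum-choose V 6 4 (λ s _ → K s)) (cong (λ c → + 15 * c)
            (trans (tsum-cong V 4 λ s → trans (tsum-const V 2 (K s)) (cong (λ c → c * K s) (square n)))
                   (tsum-*ˡ V 4 (n * n) K))))))
        (tsum-choose V 6 2 (pairTerm b)))
      where
      square : ∀ n → n ^ 2 ≡ n * n
      square n = cong (λ m → n * m) (ℤₚ.*-identityʳ n)

    weighted-density : ∀ a b c → (∀ v → length v ≡ 6 → total a (+ b) v ≤ c) →
                       a * (+ 15 * (n * n * tsum V 4 K)) ≤ n ^ 6 * c
    weighted-density a b c pointwise = begin
        a * (+ 15 * (n * n * tsum V 4 K))
      ≤⟨ ℤₚ.i≤i+j _ (+ 15 * tsum V 2 (λ p → tsum V 4 (pairTerm (+ b) p)))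
           {{ℤ.nonNegative (0≤n*i 15 (tsum-nonneg V 2 (tsum-pairTerm-nonneg b)))}} ⟩
        a * (+ 15 * (n * n * tsum V 4 K)) + + 15 * tsum V 2 (λ p → tsum V 4 (pairTerm (+ b) p))
      ≡⟨ sym (tsum-total a (+ b)) ⟩
        tsum V 6 (total a (+ b))
      ≤⟨ tsum-mono V 6 pointwise ⟩
        tsum V 6 (λ _ → c)
      ≡⟨ tsum-const V 6 c ⟩
        n ^ 6 * c ∎
      where
      open ℤₚ.≤-Reasoning

  cancel-weights : ∀ n .{{_ : ℤ.Positive n}} {a b c} e .{{_ : ℤ.Positive e}} S → a * + 15 ≡ e * b →
                   a * (+ 15 * (n * n * S)) ≤ n ^ 6 * (e * c) → b * S ≤ c * n ^ 4
  cancel-weights n {a} {b} {c} e S eq h =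
    ℤₚ.*-cancelˡ-≤-pos _ _ n (ℤₚ.*-cancelˡ-≤-pos _ _ n (ℤₚ.*-cancelˡ-≤-pos _ _ e
      (subst₂ _≤_ (trans (lemma₁ a (+ 15) n S) (trans (cong (λ x → x * (n * (n * S))) eq) (lemma₂ e b n S))) (lemma₃ n e c) h)))
    where
    lemma₁ : ∀ a k n s → a * (k * (n * n * s)) ≡ a * k * (n * (n * s))
    lemma₁ = solve-∀
    lemma₂ : ∀ e b n s → e * b * (n * (n * s)) ≡ e * (n * (n * (b * s)))
    lemma₂ = solve-∀
    lemma₃ : ∀ n e c → (n * (n * (n * (n * (n * (n * 1ℤ)))))) * (e * c) ≡ e * (n * (n * (c * (n * (n * (n * (n * 1ℤ)))))))
    lemma₃ = solve-∀

  -- The weights are integers with a common scale `e`, into which the 15 from counting 4-sets is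
  -- absorbed. Cancelling `e` and two factors `length V` turns the six-point bound into a density of
  -- 4-tuples.
  density : {A : Set} (E : A → A → A → Bool) (V : List A) .{{_ : ℤ.Positive (+ length V)}}
            {α : ℤ} {β : ℕ} {γ : ℤ} {b c : ℤ} (e : ℤ) .{{_ : ℤ.Positive e}} → α * + 15 ≡ e * b → γ ≡ e * c →
            (∀ v → length v ≡ 6 → Pattern.total E α (+ β) v ≤ γ) →
            b * tsum V 4 (Pattern.K E) ≤ c * (+ length V) ^ 4
  density E V {α} {β} {b = b} {c} e eq refl pointwise =
    cancel-weights (+ length V) {α} {b} {c} e (tsum V 4 (Pattern.K E)) eq (weighted-density E V α β _ pointwise)

-- The finite search over edge patterns on six points.

module Search where
  open Sums
  open Certificate
  open import Data.Bool using (Bool; true; false; _∧_; _∨_; if_then_else_)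
  open import Data.Bool.ListAction using (any; all)
  open import Data.Fin as F using (Fin; zero; suc; toℕ)
  import Data.Fin.Properties as F
  open import Data.Integer as ℤ using (ℤ; +_)
  open import Data.Integer.Properties as ℤₚ using ()
  open import Data.List using (List; []; _∷_; map; _++_; upTo; allFin; filterᵇ; concatMap)
  open import Data.List.Relation.Unary.All using (All; []; _∷_)
  open import Data.List.Relation.Unary.Any as Any using (Any)
  import Data.List.Relation.Unary.Any.Properties as Any
  open import Data.Maybe using (Maybe; just; nothing; fromMaybe)
  open import Data.Nat as ℕ using (ℕ; zero; suc; _≡ᵇ_; _≤ᵇ_)
  open import Data.Product using (_×_; _,_)
  open import Data.Product.Properties using (≡-dec)
  open import Data.Vec as V using (Vec; []; _∷_; lookup; tabulate)
  import Data.Vec.Properties as V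
  open import Relation.Binary using (DecidableEquality)
  open import Relation.Nullary using (yes; no)
  open import Relation.Binary.PropositionalEquality

  private variable
    A B : Set

  picks : ℕ → List A → List (List A × List A)
  picks zero    xs       = ([] , xs) ∷ []
  picks (suc k) []       = []
  picks (suc k) (x ∷ xs) =
    map (λ (l , r) → x ∷ l , r) (picks k xs) ++ map (λ (l , r) → l , x ∷ r) (picks (suc k) xs)

  Six : Set
  Six = Fin 6

  six : List Six
  six = allFin 6

  Index : Set
  Index = Six × Six × Six

  _≟ᵢ_ : DecidableEquality Index
  _≟ᵢ_ = ≡-dec F._≟_ (≡-dec F._≟_ F._≟_)

  -- Listed by increasing largest element, so that the triples inside the first
  -- k points form an initial segment.
  triangles : List Index
  triangles = concatMap (λ k → concatMap (λ j → concatMap (λ i →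
    if (toℕ i ℕ.<ᵇ toℕ j) ∧ (toℕ j ℕ.<ᵇ toℕ k) then (i , j , k) ∷ [] else []) six) six) six

  orders : Index → List Index
  orders (i , j , k) = (i , j , k) ∷ (i , k , j) ∷ (j , i , k) ∷ (j , k , i) ∷ (k , i , j) ∷ (k , j , i) ∷ []

  -- A triple with a repeated index matches nothing in `triangles` and gets a position past the end,
  -- where `bit` returns its default `false`: degenerate triples are nonedges.
  find : Index → List Index → ℕ
  find t []       = 0
  find t (u ∷ us) with Any.any? (u ≟ᵢ_) (orders t)
  ... | yes _ = 0
  ... | no  _ = suc (find t us)

  position : Six → Six → Six → ℕ
  position i j k = find (i , j , k) triangles

  Cube : Set → Set
  Cube B = Vec (Vec (Vec B 6) 6) 6

  cube : (Six → Six → Six → B) → Cube B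
  cube f = tabulate λ i → tabulate λ j → tabulate λ k → f i j k

  _!_ : Cube B → Six → Six → Six → B
  (t ! i) j k = lookup (lookup (lookup t i) j) k

  cube-! : (f : Six → Six → Six → B) → ∀ i j k → (cube f ! i) j k ≡ f i j k
  cube-! f i j k = trans
    (cong (λ v → lookup (lookup v j) k) (V.lookup∘tabulate (λ i → tabulate λ j → tabulate (f i j)) i))
    (trans (cong (λ v → lookup v k) (V.lookup∘tabulate (λ j → tabulate (f i j)) j)) (V.lookup∘tabulate (f i j) k))

  look : List Bool → ℕ → Maybe Bool
  look []       _       = nothing
  look (b ∷ bs) zero    = just b
  look (b ∷ bs) (suc i) = look bs i

  -- Undecided entries read as `false`, so in a prefix a copy is recognised only once all four of
  -- its edges are known to be present.
  bit : List Bool → ℕ → Bool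
  bit b i = fromMaybe false (look b i)

  -- ((a , b) , (c , d , e)) stands for the copy abc, abd, abe, cde of F₃,₂.
  Copy : Set
  Copy = (Six × Six) × Index

  copies : List Copy
  copies = concatMap (λ { (a ∷ b ∷ [] , r) → concatMap (λ { (c ∷ d ∷ e ∷ [] , _) → ((a , b) , (c , d , e)) ∷ []
                                                           ; _ → [] }) (picks 3 r)
                        ; _ → [] }) (picks 2 six)

  swapAt : {n : ℕ} → Fin n → Vec A (suc n) → Vec A (suc n)
  swapAt zero    (x ∷ y ∷ v) = y ∷ x ∷ v
  swapAt (suc s) (x ∷ v)     = x ∷ swapAt s v

  transpose : Fin 5 → Six → Six
  transpose s = lookup (swapAt s (V.allFin 6))

  -- Compares a prefix of a pattern lexicographically with its image under a
  -- transposition; an unknown entry of the image makes the comparison fail.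
  improves : List Bool → List Bool → List ℕ → Bool
  improves b (x ∷ xs) (q ∷ qs) with x | look b q
  ... | true  | just true  = improves b xs qs
  ... | false | just false = improves b xs qs
  ... | false | just true  = true
  ... | _     | _          = false
  improves b _ _ = false

  -- The positions of the triples are passed as a parameter so that they are
  -- computed only once when the search is evaluated.
  module _ (P : Six → Six → Six → ℕ) where

    edgesOf : Copy → List ℕ
    edgesOf ((a , b) , (c , d , e)) = P a b c ∷ P a b d ∷ P a b e ∷ P c d e ∷ []

    -- Along a branch each copy is tested once, at the level that decides its last edge.
    copiesEndingAt : ℕ → List Copy
    copiesEndingAt n = filterᵇ (λ p → any (n ≡ᵇ_) (edgesOf p) ∧ all (_≤ᵇ n) (edgesOf p)) copies

    transposed : Fin 5 → List ℕ
    transposed s = map (λ (i , j , k) → P (transpose s i) (transpose s j) (transpose s k)) triangles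

    module _ (leaf : List Bool → Bool) (ts : List (List ℕ)) where
      mutual
        search : List (List Copy) → List Bool → Bool
        search []       b = leaf b
        search (l ∷ ls) b = visit l ls (b ++ true ∷ []) ∧ visit l ls (b ++ false ∷ [])

        -- A prefix is closed off if it already contains a copy, or if some transposition makes
        -- every completion larger. Only the surviving complete patterns reach `leaf`.
        visit : List Copy → List (List Copy) → List Bool → Bool
        visit l ls b = any (λ p → all (bit b) (edgesOf p)) l ∨ any (improves b b) ts ∨ search ls b

  record Setup : Set where
    field
      points : List Six
      place  : Six → Six → Six → ℕ
      leaf   : List Bool → Bool
      moves  : List (List ℕ)
      levels : List (List Copy)

  run : Setup → Bool
  run s = search place leaf moves levels []
    where open Setup s

  fits : ℤ → ℤ → ℤ → List Six → Cube Bool → Bool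
  fits α β γ l t = Pattern.total (t !_) α β l ℤ.≤ᵇ γ

  setup : ℤ → ℤ → ℤ → List Six → Cube ℕ → Setup
  setup α β γ l t = record
    { points = l
    ; place  = t !_
    ; leaf   = λ b → fits α β γ l (cube λ i j k → bit b ((t ! i) j k))
    ; moves  = map (transposed (t !_)) (allFin 5)
    ; levels = map (copiesEndingAt (t !_)) (upTo 20)
    }

  -- In Certificate.density, 15 · 1107072 = 64 · 259470 and 7005690 = 27 · 259470.
  certificate : Setup
  certificate = setup (+ 1107072) (+ 580) (+ 7005690) six (cube position)

  -- The finite verification takes place here: checking `refl` evaluates the whole search.
  search-succeeds : run certificate ≡ true
  search-succeeds = refl

-- From the finite search to arbitrary 6-tuples of vertices.

module Soundness where
  open Sums
  open Certificate
  open Search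
  open import Data.Bool using (Bool; true; false; if_then_else_; T)
  open import Data.Bool.Properties using (T-∧; T-∨; T-≡)
  open import Data.Bool.ListAction using (any; all)
  open import Data.Empty using (⊥; ⊥-elim)
  open import Data.Fin as F using (Fin; zero; suc)
  import Data.Fin.Properties as F
  open import Data.Integer as ℤ using (ℤ; +_)
  open import Data.Integer.Properties as ℤₚ using ()
  open import Data.List using (List; []; _∷_; map; _++_; length; allFin)
  open import Data.List.Properties using (map-∘; map-cong; length-map; ++-assoc; ++-identityʳ)
  open import Data.List.Relation.Binary.Permutation.Propositional using (_↭_; ↭-refl; ↭-prep; ↭-swap)
  open import Data.List.Relation.Unary.All as All using (All; []; _∷_)
  import Data.List.Relation.Unary.All.Properties as Allₚ
  open import Data.List.Relation.Unary.Any as Any using (Any; here; there)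
  import Data.List.Relation.Unary.Any.Properties as Anyₚ
  open import Data.Maybe using (Maybe; just)
  open import Data.Nat as ℕ using (ℕ; zero; suc; _^_; _≤_; _<_; z≤n; s≤s)
  import Data.Nat.Properties as ℕₚ
  open import Data.Product using (_,_; ∃; proj₁; proj₂)
  open import Data.Sum using (_⊎_; inj₁; inj₂)
  open import Data.Unit using (tt)
  open import Data.Vec as V using (Vec; []; _∷_; lookup)
  import Data.Vec.Properties as V
  open import Function using (Equivalence)
  open import Relation.Nullary using (yes; no)
  open import Relation.Nullary.Decidable using (from-yes; _⊎-dec_)
  open import Relation.Binary.PropositionalEquality

  private variable
    A B : Set

  uncurry₃ : (Six → Six → Six → B) → Index → B
  uncurry₃ g (i , j , k) = g i j k

  -- The points in `free` may coincide, so the notion is preserved by pullback along any map,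
  -- injective or not. This is the closure under blow-ups that covers 6-tuples with repeated
  -- vertices.
  record IsPattern (g : A → A → A → Bool) : Set where
    field
      sym₁₂ : ∀ x y z → g x y z ≡ g y x z
      sym₂₃ : ∀ x y z → g x y z ≡ g x z y
      irrefl : ∀ x y → g x x y ≡ false
      free  : ∀ a b c d e → T (g a b c) → T (g a b d) → T (g a b e) → T (g c d e) → ⊥
  open IsPattern

  covered : ∀ i j k → (i ≡ j ⊎ (j ≡ k ⊎ i ≡ k)) ⊎ Any (λ u → Any (u ≡_) (orders (i , j , k))) triangles
  covered = from-yes (F.all? λ i → F.all? λ j → F.all? λ k →
    ((i F.≟ j) ⊎-dec ((j F.≟ k) ⊎-dec (i F.≟ k))) ⊎-dec
    Any.any? (λ u → Any.any? (u ≟ᵢ_) (orders (i , j , k))) triangles)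

  module _ {g : Six → Six → Six → Bool} (G : IsPattern g) where

    constant-on-orders : ∀ t → All (λ u → uncurry₃ g t ≡ uncurry₃ g u) (orders t)
    constant-on-orders (i , j , k) =
      refl ∷ sym₂₃ G i j k ∷ sym₁₂ G i j k ∷ ijk≡jki ∷ ijk≡kij ∷ trans ijk≡kij (sym₂₃ G k i j) ∷ []
      where
      ijk≡jki : g i j k ≡ g j k i
      ijk≡jki = trans (sym₁₂ G i j k) (sym₂₃ G j i k)
      ijk≡kij : g i j k ≡ g k i j
      ijk≡kij = trans (sym₂₃ G i j k) (sym₁₂ G i k j)

    bit-find : ∀ t us → Any (λ u → Any (u ≡_) (orders t)) us →
               bit (map (uncurry₃ g) us) (find t us) ≡ uncurry₃ g t
    bit-find t (u ∷ us) p with Any.any? (u ≟ᵢ_) (orders t) | p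
    ... | yes q | _       = sym (All.lookupWith (λ e f → trans e (cong (uncurry₃ g) (sym f))) (constant-on-orders t) q)
    ... | no ¬q | here q  = ⊥-elim (¬q q)
    ... | no ¬q | there p = bit-find t us p

    -- Meant for degenerate triples, for which `find` runs off the list: the default bit `false`
    -- then agrees with irreflexivity.
    bit-find-none : ∀ t us → bit (map (uncurry₃ g) us) (find t us) ≡ uncurry₃ g t ⊎
                             bit (map (uncurry₃ g) us) (find t us) ≡ false
    bit-find-none t []       = inj₂ refl
    bit-find-none t (u ∷ us) with Any.any? (u ≟ᵢ_) (orders t)
    ... | yes q = inj₁ (sym (All.lookupWith (λ e f → trans e (cong (uncurry₃ g) (sym f))) (constant-on-orders t) q))
    ... | no ¬q = bit-find-none t us

    degenerate : ∀ {i j k} → i ≡ j ⊎ (j ≡ k ⊎ i ≡ k) → g i j k ≡ false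
    degenerate {i} {j} {k} (inj₁ refl)        = irrefl G i k
    degenerate {i} {j} {k} (inj₂ (inj₁ refl)) =
      trans (sym₁₂ G i j j) (trans (sym₂₃ G j i j) (irrefl G j i))
    degenerate {i} {j} {k} (inj₂ (inj₂ refl)) = trans (sym₂₃ G i j i) (irrefl G i j)

    bit-position : ∀ i j k → bit (map (uncurry₃ g) triangles) (position i j k) ≡ g i j k
    bit-position i j k = by-cases (covered i j k)
      where
      by-cases : (i ≡ j ⊎ (j ≡ k ⊎ i ≡ k)) ⊎ Any (λ u → Any (u ≡_) (orders (i , j , k))) triangles →
                 bit (map (uncurry₃ g) triangles) (position i j k) ≡ g i j k
      by-cases (inj₂ p) = bit-find (i , j , k) triangles p
      by-cases (inj₁ d) with bit-find-none (i , j , k) triangles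
      ... | inj₁ e = e
      ... | inj₂ e = trans e (sym (degenerate d))

  -- The first bit is the most significant, so lexicographic comparison becomes comparison of
  -- numbers and yields a termination measure.
  value : List Bool → ℕ
  value []       = 0
  value (b ∷ bs) = (if b then 2 ^ length bs else 0) ℕ.+ value bs

  value<2^length : ∀ bs → value bs < 2 ^ length bs
  value<2^length []           = s≤s z≤n
  value<2^length (true  ∷ bs) = subst (λ n → 2 ^ length bs ℕ.+ value bs < 2 ^ length bs ℕ.+ n)
    (sym (ℕₚ.+-identityʳ _)) (ℕₚ.+-monoʳ-< (2 ^ length bs) (value<2^length bs))
  value<2^length (false ∷ bs) = ℕₚ.<-≤-trans (value<2^length bs) (ℕₚ.m≤m+n (2 ^ length bs) _)

  look-++ : ∀ b z q {x} → look b q ≡ just x → look (b ++ z) q ≡ just x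
  look-++ (x ∷ b) z zero    e = e
  look-++ (x ∷ b) z (suc q) e = look-++ b z q e

  bit-++ : ∀ b z q → T (bit b q) → T (bit (b ++ z) q)
  bit-++ b z q t with look b q in e
  bit-++ b z q t | just true rewrite look-++ b z q e = tt

  -- At the first difference the image gains a power of two that exceeds everything the later bits
  -- of the original can be worth. Entries read from the prefix `b` keep their value in every
  -- completion `b ++ z`.
  improves-sound : ∀ b z xs qs → length (xs ++ z) ≡ length qs → T (improves b xs qs) →
                   value (xs ++ z) < value (map (bit (b ++ z)) qs)
  improves-sound b z (x ∷ xs) (q ∷ qs) len t with x | look b q in e
  ... | true  | just true  rewrite look-++ b z q e | length-map (bit (b ++ z)) qs | sym (ℕₚ.suc-injective len) =
    ℕₚ.+-monoʳ-< (2 ^ length (xs ++ z)) (improves-sound b z xs qs (ℕₚ.suc-injective len) t)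
  ... | false | just false rewrite look-++ b z q e = improves-sound b z xs qs (ℕₚ.suc-injective len) t
  ... | false | just true  rewrite look-++ b z q e | length-map (bit (b ++ z)) qs | sym (ℕₚ.suc-injective len) =
    ℕₚ.<-≤-trans (value<2^length (xs ++ z)) (ℕₚ.m≤m+n (2 ^ length (xs ++ z)) _)
  improves-sound b z [] _ len ()
  improves-sound b z (x ∷ xs) [] () t

  module _ (P : Six → Six → Six → ℕ) (leaf : List Bool → Bool) (ts : List (List ℕ)) where

    Outcome : List Bool → Set
    Outcome l = (∃ λ c → All (λ q → T (bit l q)) (edgesOf P c))
              ⊎ (Any (λ qs → length l ≡ length qs → value l < value (map (bit l) qs)) ts
              ⊎ T (leaf l))

    mutual
      -- `z` is an arbitrary completion of the prefix. Its bits select the branch to follow, and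
      -- whatever closes that branch early persists in the full pattern.
      search-sound : ∀ ls b z → length z ≡ length ls → T (search P leaf ts ls b) → Outcome (b ++ z)
      search-sound []       b []          len t = inj₂ (inj₂ (subst (λ l → T (leaf l)) (sym (++-identityʳ b)) t))
      search-sound (l ∷ ls) b (x ∷ z)     len t =
        subst Outcome (++-assoc b (x ∷ []) z) (visit-sound l ls (b ++ x ∷ []) z (ℕₚ.suc-injective len) (branch x))
        where
        branch : ∀ x → T (visit P leaf ts l ls (b ++ x ∷ []))
        branch true  = proj₁ (Equivalence.to T-∧ t)
        branch false = proj₂ (Equivalence.to (T-∧ {visit P leaf ts l ls (b ++ true ∷ [])}) t)

      visit-sound : ∀ l ls b z → length z ≡ length ls → T (visit P leaf ts l ls b) → Outcome (b ++ z)
      visit-sound l ls b z len t with Equivalence.to (T-∨ {any (λ p → all (bit b) (edgesOf P p)) l}) t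
      ... | inj₁ u = inj₁ (copy (Anyₚ.any⁻ _ l u))
        where
        copy : Any (λ p → T (all (bit b) (edgesOf P p))) l → ∃ λ c → All (λ q → T (bit (b ++ z) q)) (edgesOf P c)
        copy p = let (c , c∈) = Any.satisfied p in c , All.map (λ {q} → bit-++ b z q) (Allₚ.all⁺ (bit b) (edgesOf P c) c∈)
      ... | inj₂ u with Equivalence.to (T-∨ {any (improves b b) ts}) u
      ...   | inj₁ w = inj₂ (inj₁ (Any.map (λ {qs} i len → improves-sound b z b qs len i) (Anyₚ.any⁻ (improves b b) ts w)))
      ...   | inj₂ w = search-sound ls b z len w

  toList-swapAt : ∀ {n} (s : Fin n) (v : Vec A (suc n)) → V.toList v ↭ V.toList (swapAt s v)
  toList-swapAt zero    (x ∷ y ∷ v) = ↭-swap x y ↭-refl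
  toList-swapAt (suc s) (x ∷ v)     = ↭-prep x (toList-swapAt s v)

  swapAt-map : ∀ {n} (h : A → B) (s : Fin n) (v : Vec A (suc n)) → swapAt s (V.map h v) ≡ V.map h (swapAt s v)
  swapAt-map h zero    (x ∷ y ∷ v) = refl
  swapAt-map h (suc s) (x ∷ v)     = cong (h x ∷_) (swapAt-map h s v)

  -- `v` is the image of the vector of indices under `lookup v`, and swapping entries commutes with
  -- mapping.
  lookup-swapAt : (v : Vec A 6) (s : Fin 5) (i : Six) → lookup (swapAt s v) i ≡ lookup v (transpose s i)
  lookup-swapAt v s i = begin
      lookup (swapAt s v) i
    ≡⟨ cong (λ w → lookup (swapAt s w) i) (sym (V.map-lookup-allFin v)) ⟩
      lookup (swapAt s (V.map (lookup v) (V.allFin 6))) i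
    ≡⟨ cong (λ w → lookup w i) (swapAt-map (lookup v) s (V.allFin 6)) ⟩
      lookup (V.map (lookup v) (swapAt s (V.allFin 6))) i
    ≡⟨ V.lookup-map i (lookup v) (swapAt s (V.allFin 6)) ⟩
      lookup v (transpose s i) ∎
    where open ≡-Reasoning

  record Valid (α β γ : ℤ) (s : Setup) : Set where
    open Setup s
    field
      points-six     : points ≡ six
      place-position : ∀ i j k → place i j k ≡ position i j k
      leaf-sound     : ∀ b → T (leaf b) → Pattern.total (cube (λ i j k → bit b (place i j k)) !_) α β points ℤ.≤ γ
      moves-sound    : All (λ qs → ∃ λ σ → qs ≡ transposed place σ) moves
      levels-length  : length levels ≡ 20

  fits-sound : ∀ α β γ l t → T (fits α β γ l t) → Pattern.total (t !_) α β l ℤ.≤ γ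
  fits-sound α β γ l t = ℤₚ.≤ᵇ⇒≤ {Pattern.total (t !_) α β l} {γ}

  setup-valid : ∀ α β γ {l t} → l ≡ six → (∀ i j k → (t ! i) j k ≡ position i j k) → Valid α β γ (setup α β γ l t)
  setup-valid α β γ {l} {t} l≡six table = record
    { points-six     = l≡six
    ; place-position = table
    ; leaf-sound     = λ b → fits-sound α β γ l (cube λ i j k → bit b ((t ! i) j k))
    ; moves-sound    = Allₚ.map⁺ (All.universal (λ σ → σ , refl) (allFin 5))
    ; levels-length  = refl
    }

  -- With s a variable the search does not unfold, which keeps conversion checks cheap.
  module _ {α β γ : ℤ} {s : Setup} (valid : Valid α β γ s) (succeeds : run s ≡ true)
           {E : A → A → A → Bool} (G : IsPattern E) where
    open Pattern E
    open Setup s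
    open Valid valid

    pullback : Vec A 6 → Six → Six → Six → Bool
    pullback v i j k = E (lookup v i) (lookup v j) (lookup v k)

    pullback-pattern : ∀ v → IsPattern (pullback v)
    pullback-pattern v = record
      { sym₁₂  = λ _ _ _ → sym₁₂ G _ _ _
      ; sym₂₃  = λ _ _ _ → sym₂₃ G _ _ _
      ; irrefl = λ _ _ → irrefl G _ _
      ; free   = λ _ _ _ _ _ → free G _ _ _ _ _
      }

    bits : Vec A 6 → List Bool
    bits v = map (uncurry₃ (pullback v)) triangles

    bit-place : ∀ v i j k → bit (bits v) (place i j k) ≡ pullback v i j k
    bit-place v i j k =
      trans (cong (bit (bits v)) (place-position i j k)) (bit-position (pullback-pattern v) i j k)

    bits-swapAt : ∀ v σ → map (bit (bits v)) (transposed place σ) ≡ bits (swapAt σ v)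
    bits-swapAt v σ = trans (sym (map-∘ {g = bit (bits v)} {f = moved} triangles)) (map-cong agree triangles)
      where
      moved : Index → ℕ
      moved (i , j , k) = place (transpose σ i) (transpose σ j) (transpose σ k)
      agree : ∀ t → bit (bits v) (moved t) ≡ uncurry₃ (pullback (swapAt σ v)) t
      agree (i , j , k) = trans (bit-place v (transpose σ i) (transpose σ j) (transpose σ k))
        (sym (cong₂ (λ f z → f z) (cong₂ E (lookup-swapAt v σ i) (lookup-swapAt v σ j)) (lookup-swapAt v σ k)))

    toList-lookup : (v : Vec A 6) → map (lookup v) six ≡ V.toList v
    toList-lookup (_ ∷ _ ∷ _ ∷ _ ∷ _ ∷ _ ∷ []) = refl

    outcome : ∀ v → Outcome place leaf moves (bits v)
    outcome v = search-sound place leaf moves levels [] (bits v) (sym levels-length) (Equivalence.from T-≡ succeeds)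

    Bounded : Vec A 6 → Set
    Bounded v = total α β (V.toList v) ℤ.≤ γ

    ascent : ∀ v → Any (λ qs → length (bits v) ≡ length qs → value (bits v) < value (map (bit (bits v)) qs)) moves →
             ∃ λ σ → value (bits v) < value (bits (swapAt σ v))
    ascent v up = All.lookupWith climb moves-sound up
      where
      climb : ∀ {qs} → (∃ λ σ → qs ≡ transposed place σ) →
              (length (bits v) ≡ length qs → value (bits v) < value (map (bit (bits v)) qs)) →
              ∃ λ σ → value (bits v) < value (bits (swapAt σ v))
      climb (σ , refl) larger = σ , subst (λ l → value (bits v) < value l) (bits-swapAt v σ) (larger refl)

    -- Transposing adjacent points while this increases the pattern terminates,
    -- since patterns are binary numbers of bounded length.
    bounded-by-ascent : ∀ N → (∀ v → value (bits v) < N) → ∀ fuel v → N ≤ value (bits v) ℕ.+ fuel → Bounded v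
    bounded-by-ascent N below fuel v h = by-cases (outcome v) fuel h
      where
      by-cases : Outcome place leaf moves (bits v) → ∀ fuel → N ≤ value (bits v) ℕ.+ fuel → Bounded v
      by-cases _ zero h = ⊥-elim (ℕₚ.<⇒≱ (below v) (subst (N ≤_) (ℕₚ.+-identityʳ _) h))
      by-cases (inj₁ (((a , b) , (c , d , e)) , abc ∷ abd ∷ abe ∷ cde ∷ [])) (suc fuel) h =
        ⊥-elim (free (pullback-pattern v) a b c d e (subst T (bit-place v a b c) abc) (subst T (bit-place v a b d) abd)
          (subst T (bit-place v a b e) abe) (subst T (bit-place v c d e) cde))
      by-cases (inj₂ (inj₁ up)) (suc fuel) h = climb (ascent v up)
        where
        climb : (∃ λ σ → value (bits v) < value (bits (swapAt σ v))) → Bounded v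
        climb (σ , larger) = subst (λ x → x ℤ.≤ γ) (sym (total-↭ (sym₁₂ G) (sym₂₃ G) α β (toList-swapAt σ v)))
          (bounded-by-ascent N below fuel (swapAt σ v) (ℕₚ.≤-trans h
            (ℕₚ.≤-trans (ℕₚ.≤-reflexive (ℕₚ.+-suc (value (bits v)) fuel)) (ℕₚ.+-monoˡ-≤ fuel larger))))
      by-cases (inj₂ (inj₂ ok)) (suc fuel) h = subst (λ x → x ℤ.≤ γ)
        (trans (sym (total-map (lookup v) agree α β points)) (cong (total α β) (trans (cong (map (lookup v)) points-six) (toList-lookup v))))
        (leaf-sound (bits v) ok)
        where
        agree : ∀ i j k → pullback v i j k ≡ (cube (λ i j k → bit (bits v) (place i j k)) ! i) j k
        agree i j k = sym (trans (cube-! (λ i j k → bit (bits v) (place i j k)) i j k) (bit-place v i j k))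

    total-bounded : ∀ l → length l ≡ 6 → total α β l ℤ.≤ γ
    total-bounded (a ∷ b ∷ c ∷ d ∷ e ∷ f ∷ []) refl =
      -- Twenty triples give values below `2 ^ 20`, so this much fuel is enough from any starting
      -- pattern.
      bounded-by-ascent (2 ^ 20) (λ v → value<2^length (bits v)) (2 ^ 20) v (ℕₚ.m≤n+m (2 ^ 20) (value (bits v)))
      where
      v : Vec A 6
      v = a ∷ b ∷ c ∷ d ∷ e ∷ f ∷ []

-- Edges and induced copies of K₄⁻ in concrete graphs.

module Graphs where
  open import Defs
  open import Data.Bool using (Bool; true; false; T; _∨_)
  import Data.Bool
  open import Data.Bool.ListAction using (any; all)
  open import Data.Bool.Solver using (module ∨-∧-Solver)
  open import Data.Nat using (ℕ)
  open import Data.Nat.Properties using (≤-decTotalOrder)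
  open import Data.List hiding (any; all)
  open Certificate
  open import Data.Integer using (1ℤ)
  open import Data.Product using (_,_; ∃; proj₁)
  open import Data.List.Relation.Unary.All as All using (All; []; _∷_)
  import Data.List.Relation.Unary.All.Properties as Allₚ
  open import Data.List.Relation.Unary.Any as Any using (Any; here)
  import Data.List.Relation.Unary.Any.Properties as Anyₚ
  open import Data.List.Relation.Binary.Permutation.Propositional using (_↭_; ↭-sym; ↭-trans; ↭-reflexive)
  import Data.List.Relation.Binary.Permutation.Propositional.Properties as ↭ₚ
  open import Data.List.Sort.InsertionSort.Base ≤-decTotalOrder using (sort)
  open import Data.List.Sort.InsertionSort.Properties ≤-decTotalOrder using (sort-↭)
  open import Data.List.Properties using (≡-dec)
  open import Relation.Nullary.Decidable using (from-yes)
  open import Relation.Nullary using (yes; no)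
  open import Relation.Binary.PropositionalEquality
  import Data.Nat as N

  T⇒≡ : ∀ {b} → T b → b ≡ true
  T⇒≡ {true} _ = refl

  edgeᵇ-sym₁₂ : ∀ G a b c → edgeᵇ G a b c ≡ edgeᵇ G b a c
  edgeᵇ-sym₁₂ G a b c = lemma (memᵇ (a , b , c) G) (memᵇ (a , c , b) G) (memᵇ (b , a , c) G)
                              (memᵇ (b , c , a) G) (memᵇ (c , a , b) G) (memᵇ (c , b , a) G)
    where
    open ∨-∧-Solver
    lemma : ∀ p q r s t u → p ∨ q ∨ r ∨ s ∨ t ∨ u ≡ r ∨ s ∨ p ∨ q ∨ u ∨ t
    lemma = solve 6 (λ p q r s t u → p :+ (q :+ (r :+ (s :+ (t :+ u)))) := r :+ (s :+ (p :+ (q :+ (u :+ t))))) refl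

  edgeᵇ-sym₂₃ : ∀ G a b c → edgeᵇ G a b c ≡ edgeᵇ G a c b
  edgeᵇ-sym₂₃ G a b c = lemma (memᵇ (a , b , c) G) (memᵇ (a , c , b) G) (memᵇ (b , a , c) G)
                              (memᵇ (b , c , a) G) (memᵇ (c , a , b) G) (memᵇ (c , b , a) G)
    where
    open ∨-∧-Solver
    lemma : ∀ p q r s t u → p ∨ q ∨ r ∨ s ∨ t ∨ u ≡ q ∨ p ∨ t ∨ u ∨ r ∨ s
    lemma = solve 6 (λ p q r s t u → p :+ (q :+ (r :+ (s :+ (t :+ u)))) := q :+ (p :+ (t :+ (u :+ (r :+ s))))) refl

  -- Decided by evaluation: each of the 24 injections is sorted and compared with the list of
  -- indices.
  injections-↭ : All (λ σ → map (nth σ) (upTo 4) ↭ upTo 4) (injections 4 4)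
  injections-↭ = All.map (λ {σ} e → ↭-trans (↭-sym (sort-↭ (map (nth σ) (upTo 4)))) (↭-reflexive e))
    (from-yes (All.all? (λ σ → ≡-dec N._≟_ (sort (map (nth σ) (upTo 4))) (upTo 4)) (injections 4 4)))

  module _ (h : ℕ) (H G : Graph) (S : List ℕ) where

    Matches : List ℕ → Triple → Set
    Matches σ (a , b , c) = edgeᵇ H a b c ≡ edgeᵇ G (nth S (nth σ a)) (nth S (nth σ b)) (nth S (nth σ c))

    -- Gives access to the anonymous test inside inducesᵇ.
    inducesᵇ-test : ∃ λ (f : List ℕ → Triple → Bool) → inducesᵇ h H G S ≡ any (λ σ → all (f σ) (triples h)) (injections h h)
    inducesᵇ-test = _ , refl

    test⇒matches : ∀ σ τ → T (proj₁ inducesᵇ-test σ τ) → Matches σ τ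
    test⇒matches σ (a , b , c) v
      with edgeᵇ H a b c Data.Bool.≟ edgeᵇ G (nth S (nth σ a)) (nth S (nth σ b)) (nth S (nth σ c)) | v
    ... | yes e | _ = e
    ... | no _  | ()

    matches⇒test : ∀ σ τ → Matches σ τ → T (proj₁ inducesᵇ-test σ τ)
    matches⇒test σ (a , b , c) e
      with edgeᵇ H a b c Data.Bool.≟ edgeᵇ G (nth S (nth σ a)) (nth S (nth σ b)) (nth S (nth σ c))
    ... | yes _ = _
    ... | no ¬e = ¬e e

    induces⇒matches : T (inducesᵇ h H G S) → Any (λ σ → All (Matches σ) (triples h)) (injections h h)
    induces⇒matches t = Any.map (λ {σ} u → All.map (λ {τ} → test⇒matches σ τ) (Allₚ.all⁺ (proj₁ inducesᵇ-test σ) (triples h) u))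
      (Anyₚ.any⁻ (λ σ → all (proj₁ inducesᵇ-test σ) (triples h)) (injections h h) t)

    matches⇒induces : Any (λ σ → All (Matches σ) (triples h)) (injections h h) → T (inducesᵇ h H G S)
    matches⇒induces m = Anyₚ.any⁺ (λ σ → all (proj₁ inducesᵇ-test σ) (triples h))
      (Any.map (λ {σ} ms → Allₚ.all⁻ (proj₁ inducesᵇ-test σ) (All.map (λ {τ} → matches⇒test σ τ) ms)) m)

  K-three : ∀ {A : Set} (e : A → A → A → Bool) w x y z → e w x y ≡ true → e w x z ≡ true → e w y z ≡ true → e x y z ≡ false →
            Pattern.K e (w ∷ x ∷ y ∷ z ∷ []) ≡ 1ℤ
  K-three e w x y z p q r s rewrite p | q | r | s = refl

  -- The isomorphism only reorders the four points, and `K` is invariant under reordering, so the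
  -- points may be assumed to match the labels of `K4⁻`.
  induces⇒K : ∀ G a b c d → T (inducesᵇ 4 K4⁻ G (a ∷ b ∷ c ∷ d ∷ [])) → Pattern.K (edgeᵇ G) (a ∷ b ∷ c ∷ d ∷ []) ≡ 1ℤ
  induces⇒K G a b c d t = All.lookupWith (λ {σ} → count {σ}) injections-↭ (induces⇒matches 4 K4⁻ G s t)
    where
    s : List ℕ
    s = a ∷ b ∷ c ∷ d ∷ []
    count : ∀ {σ} → map (nth σ) (upTo 4) ↭ upTo 4 → All (Matches 4 K4⁻ G s σ) (triples 4) → Pattern.K (edgeᵇ G) s ≡ 1ℤ
    -- `sublists` puts the sublists without the head first, so `triples 4` runs from 123 to 012.
    count {σ} p (e₁₂₃ ∷ e₀₂₃ ∷ e₀₁₃ ∷ e₀₁₂ ∷ []) =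
      trans (sym (K-↭ (edgeᵇ-sym₁₂ G) (edgeᵇ-sym₂₃ G) (↭ₚ.map⁺ (nth s) p)))
            (K-three (edgeᵇ G) (v 0) (v 1) (v 2) (v 3) (sym e₀₁₂) (sym e₀₁₃) (sym e₀₂₃) (sym e₁₂₃))
      where
      v : ℕ → ℕ
      v i = nth s (nth σ i)

  K4⁻-induces : ∀ G a b c d → edgeᵇ G a b c ≡ true → edgeᵇ G a b d ≡ true → edgeᵇ G a c d ≡ true → edgeᵇ G b c d ≡ false →
                T (inducesᵇ 4 K4⁻ G (a ∷ b ∷ c ∷ d ∷ []))
  K4⁻-induces G a b c d e₀₁₂ e₀₁₃ e₀₂₃ e₁₂₃ = matches⇒induces 4 K4⁻ G (a ∷ b ∷ c ∷ d ∷ [])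
    -- The first injection in the list is the identity.
    (here (sym e₁₂₃ ∷ sym e₀₂₃ ∷ sym e₀₁₃ ∷ sym e₀₁₂ ∷ []))

-- The upper bound for every F₃,₂-free graph.

module UpperBound where
  open import Defs
  open Sums
  open Certificate
  open Search
  open Soundness
  open Graphs
  open import Data.Bool using (Bool; true; false; T; _∨_)
  import Data.Bool as Bool
  open import Data.Bool.Properties using (T-∧)
  open import Data.Bool.ListAction using (any; all)
  open import Data.Empty using (⊥; ⊥-elim)
  open import Data.Nat as ℕ using (ℕ; zero; suc; _<_; _≤_; z≤n)
  import Data.Nat.Properties as ℕₚ
  open import Data.Integer as ℤ using (ℤ; +_; 0ℤ; 1ℤ)
  open import Data.Integer.Properties as ℤₚ using ()
  open import Data.List hiding (any; all; _∷ʳ_)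
  open import Data.List.Properties using (filter-++; length-upTo)
  open import Data.List.Membership.Propositional using (_∈_; _∉_)
  open import Data.List.Membership.Propositional.Properties using (∈-concatMap⁺; ∈-map⁺; ∈-filter⁺; ∈-upTo⁺; ∈-++⁺ˡ; ∈-++⁺ʳ)
  open import Data.List.Relation.Binary.Sublist.Propositional using (_⊆_; []; _∷_; _∷ʳ_)
  open import Data.List.Relation.Binary.Sublist.Propositional.Properties using (All-resp-⊆)
  open import Data.List.Relation.Unary.All as All using (All; []; _∷_)
  import Data.List.Relation.Unary.All.Properties as Allₚ
  open import Data.List.Relation.Unary.AllPairs as AllPairs using (AllPairs; []; _∷_)
  import Data.List.Relation.Unary.AllPairs.Properties as AllPairsₚ
  open import Data.List.Relation.Unary.Any as Any using (Any; here; there)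
  import Data.List.Relation.Unary.Any.Properties as Anyₚ
  open import Data.Product using (_×_; _,_; ∃; proj₂)
  open import Function using (_∘_; id; mk⇔; Equivalence)
  open import Relation.Nullary using (¬_; Dec; does; yes; no; ¬?)
  open import Relation.Nullary.Decidable using (_×-dec_; does-⇔; dec-false)
  open import Relation.Unary using (Decidable)
  open import Relation.Binary.PropositionalEquality

  private variable
    A : Set

  sublists-⊆ : (xs : List A) → All (_⊆ xs) (sublists xs)
  sublists-⊆ []       = [] ∷ []
  sublists-⊆ (x ∷ xs) = Allₚ.++⁺ (All.map (x ∷ʳ_) (sublists-⊆ xs)) (Allₚ.map⁺ (All.map (refl ∷_) (sublists-⊆ xs)))

  ⊆⇒∈-sublists : {s xs : List A} → s ⊆ xs → s ∈ sublists xs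
  ⊆⇒∈-sublists []                   = here refl
  ⊆⇒∈-sublists {xs = x ∷ xs} (y ∷ʳ p)   = ∈-++⁺ˡ (⊆⇒∈-sublists p)
  ⊆⇒∈-sublists {xs = x ∷ xs} (refl ∷ p) = ∈-++⁺ʳ (sublists xs) (∈-map⁺ (x ∷_) (⊆⇒∈-sublists p))

  AllPairs-⊆ : {R : A → A → Set} {xs ys : List A} → xs ⊆ ys → AllPairs R ys → AllPairs R xs
  AllPairs-⊆ []         []       = []
  AllPairs-⊆ (y ∷ʳ p)   (_ ∷ rs) = AllPairs-⊆ p rs
  AllPairs-⊆ (refl ∷ p) (r ∷ rs) = All-resp-⊆ p r ∷ AllPairs-⊆ p rs

  upTo-increasing : ∀ n → AllPairs _<_ (upTo n)
  upTo-increasing n = AllPairsₚ.applyUpTo⁺₁ id n (λ i<j _ → i<j)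

  kSublists : ℕ → List A → List (List A)
  kSublists k xs = filter (λ s → length s ℕₚ.≟ k) (sublists xs)

  -- Bridges the filtered enumeration that counts vertex sets and the recursion of `choose`.
  -- Sublists without the head come first in one and last in the other, hence the use of
  -- commutativity.
  ∑-kSublists : (k : ℕ) (xs : List A) (f : List A → ℤ) → ∑ (kSublists k xs) f ≡ choose k xs (λ l _ → f l)
  ∑-kSublists zero    []       f = ℤₚ.+-identityʳ (f [])
  ∑-kSublists (suc k) []       f = refl
  ∑-kSublists k       (x ∷ xs) f = begin
      ∑ (filter P? (r ++ map (x ∷_) r)) f
    ≡⟨ cong (λ l → ∑ l f) (filter-++ P? r (map (x ∷_) r)) ⟩
      ∑ (filter P? r ++ filter P? (map (x ∷_) r)) f
    ≡⟨ ∑-++ f (filter P? r) (filter P? (map (x ∷_) r)) ⟩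
      ∑ (filter P? r) f ℤ.+ ∑ (filter P? (map (x ∷_) r)) f
    ≡⟨ cong₂ ℤ._+_ (∑-kSublists k xs f) refl ⟩
      choose k xs (λ l _ → f l) ℤ.+ ∑ (filter P? (map (x ∷_) r)) f
    ≡⟨ extend k ⟩
      choose k (x ∷ xs) (λ l _ → f l) ∎
    where
    open ≡-Reasoning
    r = sublists xs
    P? : Decidable (λ s → length s ≡ k)
    P? s = length s ℕₚ.≟ k
    none : ∀ ss → filter (λ s → length s ℕₚ.≟ 0) (map (x ∷_) ss) ≡ []
    none []       = refl
    none (s ∷ ss) = none ss
    shift : ∀ k ss → ∑ (filter (λ s → length s ℕₚ.≟ suc k) (map (x ∷_) ss)) f ≡
                     ∑ (filter (λ s → length s ℕₚ.≟ k) ss) (λ l → f (x ∷ l))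
    shift k []       = refl
    shift k (s ∷ ss) with length s ℕ.≡ᵇ k
    ... | true  = +-congˡ (f (x ∷ s)) (shift k ss)
    ... | false = shift k ss
    extend : ∀ k → choose k xs (λ l _ → f l) ℤ.+ ∑ (filter (λ s → length s ℕₚ.≟ k) (map (x ∷_) r)) f ≡
                   choose k (x ∷ xs) (λ l _ → f l)
    extend zero    = trans (cong (λ l → f [] ℤ.+ ∑ l f) (none r)) (ℤₚ.+-identityʳ (f []))
    extend (suc k) = trans (ℤₚ.+-comm (choose (suc k) xs (λ l _ → f l)) _)
      (cong₂ ℤ._+_ (trans (shift k r) (∑-kSublists k xs (λ l → f (x ∷ l)))) refl)

  length-filter≤∑ : {P : A → Set} (P? : Decidable P) {f : A → ℤ} (xs : List A) → (∀ x → 0ℤ ℤ.≤ f x) →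
                    All (λ x → P x → 1ℤ ℤ.≤ f x) xs → + length (filter P? xs) ℤ.≤ ∑ xs f
  length-filter≤∑ P? []       pos []       = ℤₚ.≤-refl
  length-filter≤∑ P? {f} (x ∷ xs) pos (h ∷ hs) with P? x
  ... | yes p = ℤₚ.+-mono-≤ (h p) (length-filter≤∑ P? xs pos hs)
  ... | no _  = ℤₚ.+-mono-≤ (pos x) (length-filter≤∑ P? xs pos hs)

  ∑≤length-filter : {P : A → Set} (P? : Decidable P) {f : A → ℤ} (xs : List A) → (∀ x → f x ℤ.≤ 1ℤ) →
                    All (λ x → ¬ P x → f x ℤ.≤ 0ℤ) xs → ∑ xs f ℤ.≤ + length (filter P? xs)
  ∑≤length-filter P? []       le []       = ℤₚ.≤-refl
  ∑≤length-filter P? {f} (x ∷ xs) le (h ∷ hs) with P? x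
  ... | yes p = ℤₚ.+-mono-≤ (le x) (∑≤length-filter P? xs le hs)
  ... | no ¬p = ℤₚ.+-mono-≤ (h ¬p) (∑≤length-filter P? xs le hs)

  elemᵇ-∉ : ∀ x xs → x ∉ xs → elemᵇ x xs ≡ false
  elemᵇ-∉ x []       h = refl
  elemᵇ-∉ x (y ∷ ys) h with x ℕ.≡ᵇ y in e
  ... | true  = ⊥-elim (h (here (ℕₚ.≡ᵇ⇒≡ x y (subst T (sym e) _))))
  ... | false = elemᵇ-∉ x ys (h ∘ there)

  ∈-injections : ∀ k {n xs v} → xs ∈ injections k n → v < n → v ∉ xs → xs ++ v ∷ [] ∈ injections (suc k) n
  ∈-injections k {xs = xs} {v} p v<n v∉xs = ∈-concatMap⁺ _ (Any.map (λ { refl →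
    ∈-map⁺ (λ v → xs ++ v ∷ []) (∈-filter⁺ (λ v → Bool._≟_ (elemᵇ v xs) false) (∈-upTo⁺ v<n) (elemᵇ-∉ v xs v∉xs)) }) p)

  increasing⁴ : ∀ {n s} → s ⊆ upTo n → length s ≡ 4 →
                ∃ λ a → ∃ λ b → ∃ λ c → ∃ λ d → s ≡ a ∷ b ∷ c ∷ d ∷ [] × (a < b × b < c × c < d × d < n)
  increasing⁴ {n} {a ∷ b ∷ c ∷ d ∷ []} p refl with AllPairs-⊆ p (upTo-increasing n) | All-resp-⊆ p (Allₚ.all-upTo n)
  ... | (a<b ∷ _) ∷ (b<c ∷ _) ∷ (c<d ∷ _) ∷ _ | _ ∷ _ ∷ _ ∷ d<n ∷ [] = a , b , c , d , refl , a<b , b<c , c<d , d<n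

  T-does : {P : Set} (P? : Dec P) → T (does P?) → P
  T-does (yes p) _ = p

  module _ (n : ℕ) (G : Graph) where

    -- An arbitrary edge list may mention repeated vertices or vertices not below `n`. Excluding
    -- these gives an irreflexive relation whose copies of F₃,₂ are copies in `G`, without changing
    -- the edges spanned by the vertex set.
    Proper : ℕ → ℕ → ℕ → Set
    Proper x y z = (x ≢ y × y ≢ z × x ≢ z) × (x < n × y < n × z < n) × T (edgeᵇ G x y z)

    proper? : ∀ x y z → Dec (Proper x y z)
    proper? x y z = (¬? (x ℕₚ.≟ y) ×-dec ¬? (y ℕₚ.≟ z) ×-dec ¬? (x ℕₚ.≟ z)) ×-dec
                    (x ℕₚ.<? n ×-dec y ℕₚ.<? n ×-dec z ℕₚ.<? n) ×-dec Bool.T? (edgeᵇ G x y z)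

    properᵇ : ℕ → ℕ → ℕ → Bool
    properᵇ x y z = does (proper? x y z)

    T-properᵇ : ∀ {x y z} → T (properᵇ x y z) → Proper x y z
    T-properᵇ {x} {y} {z} = T-does (proper? x y z)

    -- The four edges cover all ten pairs of the five points, so distinctness within each edge
    -- already makes the embedding injective.
    contains : ∀ a b c d e → Proper a b c → Proper a b d → Proper a b e → Proper c d e → T (containsᵇ 5 F32 n G)
    contains a b c d e ((ab , bc , ac) , (a<n , b<n , c<n) , abc) ((_ , bd , ad) , (_ , _ , d<n) , abd)
      ((_ , be , ae) , (_ , _ , e<n) , abe) ((cd , de , ce) , _ , cde) =
      Anyₚ.any⁺ _ (Any.map (λ { refl → edges }) copy)
      where
      edges = Equivalence.from T-∧ (abc , Equivalence.from T-∧ (abd , Equivalence.from T-∧ (abe , Equivalence.from (T-∧ {edgeᵇ G c d e}) (cde , _))))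
      copy : a ∷ b ∷ c ∷ d ∷ e ∷ [] ∈ injections 5 n
      copy = ∈-injections 4 (∈-injections 3 (∈-injections 2 (∈-injections 1 (∈-injections 0 (here refl)
        a<n (λ ()))
        b<n (λ { (here e) → ab (sym e) ; (there ()) }))
        c<n (λ { (here e) → ac (sym e) ; (there (here e)) → bc (sym e) }))
        d<n (λ { (here e) → ad (sym e) ; (there (here e)) → bd (sym e) ; (there (there (here e))) → cd (sym e) }))
        e<n (λ { (here e) → ae (sym e) ; (there (here e)) → be (sym e) ; (there (there (here e))) → ce (sym e)
               ; (there (there (there (here e)))) → de (sym e) })

    module _ (F32-free : freeᵇ ((5 , F32) ∷ []) n G ≡ true) where

      properᵇ-pattern : IsPattern properᵇ
      properᵇ-pattern = record
        { sym₁₂  = λ x y z → does-⇔ (mk⇔ swap₁₂ swap₁₂) (proper? x y z) (proper? y x z)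
        ; sym₂₃  = λ x y z → does-⇔ (mk⇔ swap₂₃ swap₂₃) (proper? x y z) (proper? x z y)
        ; irrefl = irrefl
        ; free   = λ a b c d e p q r s → not-contained (contains a b c d e (T-properᵇ p) (T-properᵇ q) (T-properᵇ r) (T-properᵇ s))
        }
        where
        swap₁₂ : ∀ {x y z} → Proper x y z → Proper y x z
        swap₁₂ {x} {y} {z} ((xy , yz , xz) , (x<n , y<n , z<n) , e) =
          (xy ∘ sym , xz , yz) , (y<n , x<n , z<n) , subst T (edgeᵇ-sym₁₂ G x y z) e
        swap₂₃ : ∀ {x y z} → Proper x y z → Proper x z y
        swap₂₃ {x} {y} {z} ((xy , yz , xz) , (x<n , y<n , z<n) , e) =
          (xz , yz ∘ sym , xy) , (x<n , z<n , y<n) , subst T (edgeᵇ-sym₂₃ G x y z) e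
        irrefl : ∀ x y → properᵇ x x y ≡ false
        irrefl x y = dec-false (proper? x x y) (λ ((xx , _) , _) → xx refl)
        not-contained : ¬ T (containsᵇ 5 F32 n G)
        not-contained t = refute (containsᵇ 5 F32 n G) t F32-free
          where
          refute : ∀ b → T b → Bool.not (b ∨ false) ≡ true → ⊥
          refute true _ ()

    properᵇ-edgeᵇ : ∀ {x y z} → x < y → y < z → z < n → properᵇ x y z ≡ edgeᵇ G x y z
    properᵇ-edgeᵇ {x} {y} {z} x<y y<z z<n =
      does-⇔ (mk⇔ (λ p → proj₂ (proj₂ p)) (λ e →
        (ℕₚ.<⇒≢ x<y , ℕₚ.<⇒≢ y<z , ℕₚ.<⇒≢ (ℕₚ.<-trans x<y y<z)) ,
        (ℕₚ.<-trans x<y (ℕₚ.<-trans y<z z<n) , ℕₚ.<-trans y<z z<n , z<n) , e)) (proper? x y z) (Bool.T? (edgeᵇ G x y z))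

    isThree-nonneg : ∀ i → 0ℤ ℤ.≤ isThree i
    isThree-nonneg (+ 0) = ℤₚ.≤-refl
    isThree-nonneg (+ 1) = ℤₚ.≤-refl
    isThree-nonneg (+ 2) = ℤₚ.≤-refl
    isThree-nonneg (+ 3) = ℤ.+≤+ z≤n
    isThree-nonneg (+ suc (suc (suc (suc _)))) = ℤₚ.≤-refl
    isThree-nonneg (ℤ.-[1+ _ ]) = ℤₚ.≤-refl

    open Pattern properᵇ

    -- On increasing lists below `n` proper edges and edges agree, so every induced copy is seen by
    -- `K`.
    eH≤choose : + eH 4 K4⁻ n G ℤ.≤ choose 4 (upTo n) (λ l _ → K l)
    eH≤choose = subst (λ x → + eH 4 K4⁻ n G ℤ.≤ x) (∑-kSublists 4 (upTo n) K)
      (length-filter≤∑ (λ S → Bool._≟_ (inducesᵇ 4 K4⁻ G S) true) (kSubsets 4 n) (λ l → isThree-nonneg _) (All.map (λ {s} (p , q) → counted s q p) both))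
      where
      both : All (λ s → length s ≡ 4 × s ⊆ upTo n) (kSubsets 4 n)
      both = All.zip (Allₚ.all-filter _ (sublists (upTo n)) , Allₚ.filter⁺ (λ s → length s ℕₚ.≟ 4) (sublists-⊆ (upTo n)))
      counted : ∀ s → s ⊆ upTo n → length s ≡ 4 → inducesᵇ 4 K4⁻ G s ≡ true → 1ℤ ℤ.≤ K s
      counted s p len e with increasing⁴ p len
      ... | a , b , c , d , refl , a<b , b<c , c<d , d<n = ℤₚ.≤-reflexive (sym (trans same
              (induces⇒K G a b c d (subst T (sym e) _))))
        where
        same : K (a ∷ b ∷ c ∷ d ∷ []) ≡ Pattern.K (edgeᵇ G) (a ∷ b ∷ c ∷ d ∷ [])
        same rewrite properᵇ-edgeᵇ a<b b<c (ℕₚ.<-trans c<d d<n) | properᵇ-edgeᵇ a<b (ℕₚ.<-trans b<c c<d) d<n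
                   | properᵇ-edgeᵇ (ℕₚ.<-trans a<b b<c) c<d d<n | properᵇ-edgeᵇ b<c c<d d<n = refl

    module _ .{{_ : ℕ.NonZero n}} (F32-free : freeᵇ ((5 , F32) ∷ []) n G ≡ true) where

      pos-^ : ∀ m k → + (m ℕ.^ k) ≡ (+ m) ℤ.^ k
      pos-^ m zero    = refl
      pos-^ m (suc k) = trans (ℤₚ.pos-* m (m ℕ.^ k)) (cong (λ i → + m ℤ.* i) (pos-^ m k))

      tsum-K-bound : + 64 ℤ.* tsum (upTo n) 4 K ℤ.≤ + 27 ℤ.* (+ n) ℤ.^ 4
      tsum-K-bound = subst (λ m → + 64 ℤ.* tsum (upTo n) 4 K ℤ.≤ + 27 ℤ.* (+ m) ℤ.^ 4) (length-upTo n)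
        (density properᵇ (upTo n) {{positive}} {+ 1107072} {580} {+ 7005690} {+ 64} {+ 27} (+ 259470) refl refl
          (total-bounded {s = certificate}
            (setup-valid (+ 1107072) (+ 580) (+ 7005690) {six} {cube position} refl (cube-! position)) search-succeeds
            (properᵇ-pattern F32-free)))
        where
        positive : ℤ.Positive (+ length (upTo n))
        positive = subst (λ m → ℤ.Positive (+ m)) (sym (length-upTo n)) (ℤ.positive (ℤ.+<+ (ℕₚ.n≢0⇒n>0 (ℕ.≢-nonZero⁻¹ n))))

      -- 1536 = 64 · 4!, where 64 is the denominator of the density bound and 4! comes from passing
      -- between 4-sets and 4-tuples.
      eH-bound : 1536 ℕ.* eH 4 K4⁻ n G ≤ 27 ℕ.* n ℕ.^ 4
      eH-bound = ℤₚ.drop‿+≤+ (begin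
          + (1536 ℕ.* e)
        ≡⟨ trans (ℤₚ.pos-* 1536 e) (ℤₚ.*-assoc (+ 64) (+ 24) (+ e)) ⟩
          + 64 ℤ.* (+ 24 ℤ.* + e)
        ≤⟨ ℤₚ.*-monoˡ-≤-nonNeg (+ 64) (ℤₚ.≤-trans (ℤₚ.*-monoˡ-≤-nonNeg (+ 24) eH≤choose)
             (factorial-choose≤tsum (upTo n) 4 (λ l → isThree-nonneg _)
               (K-↭ (IsPattern.sym₁₂ (properᵇ-pattern F32-free)) (IsPattern.sym₂₃ (properᵇ-pattern F32-free))))) ⟩
          + 64 ℤ.* tsum (upTo n) 4 K
        ≤⟨ tsum-K-bound ⟩
          + 27 ℤ.* (+ n) ℤ.^ 4
        ≡⟨ sym (trans (ℤₚ.pos-* 27 (n ℕ.^ 4)) (cong (λ i → + 27 ℤ.* i) (pos-^ n 4))) ⟩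
          + (27 ℕ.* n ℕ.^ 4) ∎)
        where
        open ℤₚ.≤-Reasoning
        e = eH 4 K4⁻ n G

-- The lower bound construction and its count of K₄⁻.

module LowerBound where
  open import Defs
  open Sums
  open Certificate using (⟦_⟧)
  open Graphs
  open UpperBound
  open import Data.Bool using (Bool; true; false; T; _∨_; _∧_; not; if_then_else_)
  import Data.Bool as Bool
  open import Data.Bool.Properties using (T-∨; T-∧)
  open import Data.Bool.ListAction using (any; all)
  open import Data.Empty using (⊥; ⊥-elim)
  open import Data.Nat as ℕ using (ℕ; zero; suc; _≤_; _⊔_; z≤n; _<ᵇ_)
  import Data.Nat.Properties as ℕₚ
  open import Data.Nat.Combinatorics using (_C_; nCk+nC[k+1]≡[n+1]C[k+1])
  open import Data.Integer as ℤ using (ℤ; +_; 0ℤ; 1ℤ)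
  open import Data.Integer.Properties as ℤₚ using ()
  open import Data.List hiding (any; all; _∷ʳ_)
  open import Data.List.Properties using (length-applyUpTo)
  open import Data.List.Membership.Propositional using (_∈_)
  open import Data.List.Membership.Propositional.Properties using (∈-map⁺; ∈-filter⁺; ∈-filter⁻)
  open import Data.List.Relation.Binary.Sublist.Propositional using (_⊆_; []; _∷_; _∷ʳ_; ⊆-trans)
  open import Data.List.Relation.Binary.Sublist.Propositional.Properties using (filter-⊆)
  open import Data.List.Relation.Unary.All as All using (All; []; _∷_)
  import Data.List.Relation.Unary.All.Properties as Allₚ
  open import Data.List.Relation.Unary.Any as Any using (Any; here; there)
  import Data.List.Relation.Unary.Any.Properties as Anyₚ
  open import Data.Product using (_×_; _,_; ∃; proj₁; proj₂)
  open import Data.Sum using (_⊎_; inj₁; [_,_]′)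
  open import Function using (_∘_; id; Equivalence)
  open import Relation.Nullary using (¬_)
  open import Relation.Binary.PropositionalEquality

  private variable
    A : Set

  exactlyOne : Bool → Bool → Bool → Bool
  exactlyOne true  y z = not y ∧ not z
  exactlyOne false y z = if y then not z else z

  exactlyOne-sym₁₂ : ∀ x y z → exactlyOne x y z ≡ exactlyOne y x z
  exactlyOne-sym₁₂ true  true  z = refl
  exactlyOne-sym₁₂ true  false z = refl
  exactlyOne-sym₁₂ false true  z = refl
  exactlyOne-sym₁₂ false false z = refl

  exactlyOne-sym₂₃ : ∀ x y z → exactlyOne x y z ≡ exactlyOne x z y
  exactlyOne-sym₂₃ true  true  true  = refl
  exactlyOne-sym₂₃ true  true  false = refl
  exactlyOne-sym₂₃ true  false true  = refl
  exactlyOne-sym₂₃ true  false false = refl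
  exactlyOne-sym₂₃ false true  true  = refl
  exactlyOne-sym₂₃ false true  false = refl
  exactlyOne-sym₂₃ false false true  = refl
  exactlyOne-sym₂₃ false false false = refl

  exactlyOne-F32 : ∀ a b c d e → T (exactlyOne a b c) → T (exactlyOne a b d) → T (exactlyOne a b e) → T (exactlyOne c d e) → ⊥
  exactlyOne-F32 true  false false false false _ _ _ ()
  exactlyOne-F32 false true  false false false _ _ _ ()
  exactlyOne-F32 false false true  true  true  _ _ _ ()

  eqTᵇ-sound : ∀ s t → T (eqTᵇ s t) → s ≡ t
  eqTᵇ-sound (a , b , c) (x , y , z) h with Equivalence.to T-∧ h
  ... | p , h′ with Equivalence.to (T-∧ {b ℕ.≡ᵇ y}) h′
  ...   | q , r = cong₂ _,_ (ℕₚ.≡ᵇ⇒≡ a x p) (cong₂ _,_ (ℕₚ.≡ᵇ⇒≡ b y q) (ℕₚ.≡ᵇ⇒≡ c z r))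

  eqTᵇ-refl : ∀ t → T (eqTᵇ t t)
  eqTᵇ-refl (a , b , c) = Equivalence.from T-∧ (ℕₚ.≡⇒≡ᵇ a a refl ,
    Equivalence.from (T-∧ {b ℕ.≡ᵇ b}) (ℕₚ.≡⇒≡ᵇ b b refl , ℕₚ.≡⇒≡ᵇ c c refl))

  memᵇ⇒∈ : ∀ t G → T (memᵇ t G) → t ∈ G
  memᵇ⇒∈ t G h = Any.map (λ {s} → eqTᵇ-sound t s) (Anyₚ.any⁻ (eqTᵇ t) G h)

  ∈⇒memᵇ : ∀ {t G} → t ∈ G → T (memᵇ t G)
  ∈⇒memᵇ {t} p = Anyₚ.any⁺ (eqTᵇ t) (Any.map (λ { refl → eqTᵇ-refl t }) p)

  ∈-triples : ∀ {a b c n} → a ∷ b ∷ c ∷ [] ⊆ upTo n → (a , b , c) ∈ triples n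
  ∈-triples p = ∈-map⁺ toTriple (∈-filter⁺ (λ s → length s ℕₚ.≟ 3) (⊆⇒∈-sublists p) refl)

  module _ (k : ℕ) (F : Graph) (n : ℕ) (G : Graph) where

    -- Names the anonymous test inside `containsᵇ`, so that the lemmas on `any` and `all` can be
    -- applied to it.
    containsᵇ-test : ∃ λ (f : List ℕ → Triple → Bool) → containsᵇ k F n G ≡ any (λ φ → all (f φ) F) (injections k n)
    containsᵇ-test = _ , refl

    contains⇒copy : T (containsᵇ k F n G) → ∃ λ φ → All (λ (a , b , c) → T (edgeᵇ G (nth φ a) (nth φ b) (nth φ c))) F
    contains⇒copy t with Any.satisfied (Anyₚ.any⁻ (λ φ → all (proj₁ containsᵇ-test φ) F) (injections k n) t)
    ... | φ , u = φ , Allₚ.all⁺ (proj₁ containsᵇ-test φ) F u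

  module _ (m n : ℕ) where

    -- The distinguished part B of the construction is the initial segment of length `m`.
    small : ℕ → Bool
    small x = x <ᵇ m

    crosses : Triple → Bool
    crosses (a , b , c) = exactlyOne (small a) (small b) (small c)

    cut : Graph
    cut = filterᵇ crosses (triples n)

    cut∈allGraphs : cut ∈ allGraphs n
    cut∈allGraphs = ⊆⇒∈-sublists (filter-⊆ (Bool.T? ∘ crosses) (triples n))

    -- `edgeᵇ` tries six orders of the triple; the symmetries of `exactlyOne` bring each of them
    -- back to `a`, `b`, `c`.
    cut⇒crosses : ∀ a b c → T (edgeᵇ cut a b c) → T (crosses (a , b , c))
    cut⇒crosses a b c h = [ mem a b c , [ s₂₃ a c b ∘ mem a c b , [ s₁₂ b a c ∘ mem b a c , [ s₁₂ b a c ∘ s₂₃ b c a ∘ mem b c a ,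
        [ s₂₃ a c b ∘ s₁₂ c a b ∘ mem c a b , s₁₂ b a c ∘ s₂₃ b c a ∘ s₁₂ c b a ∘ mem c b a ]′
        ∘ T∨ (memᵇ (c , a , b) cut) ]′ ∘ T∨ (memᵇ (b , c , a) cut) ]′ ∘ T∨ (memᵇ (b , a , c) cut) ]′ ∘ T∨ (memᵇ (a , c , b) cut) ]′
        (T∨ (memᵇ (a , b , c) cut) h)
      where
      T∨ : ∀ x {y} → T (x ∨ y) → T x ⊎ T y
      T∨ x = Equivalence.to (T-∨ {x})
      mem : ∀ x y z → T (memᵇ (x , y , z) cut) → T (crosses (x , y , z))
      mem x y z p = proj₂ (∈-filter⁻ (Bool.T? ∘ crosses) {xs = triples n} (memᵇ⇒∈ (x , y , z) cut p))
      s₁₂ : ∀ x y z → T (crosses (x , y , z)) → T (crosses (y , x , z))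
      s₁₂ x y z = subst T (exactlyOne-sym₁₂ (small x) (small y) (small z))
      s₂₃ : ∀ x y z → T (crosses (x , y , z)) → T (crosses (x , z , y))
      s₂₃ x y z = subst T (exactlyOne-sym₂₃ (small x) (small y) (small z))

    cut-free : freeᵇ ((5 , F32) ∷ []) n cut ≡ true
    cut-free = absent (containsᵇ 5 F32 n cut) λ t → no-copy (contains⇒copy 5 F32 n cut t)
      where
      absent : ∀ b → ¬ T b → not (b ∨ false) ≡ true
      absent true  h = ⊥-elim (h _)
      absent false h = refl
      no-copy : (∃ λ φ → All (λ (a , b , c) → T (edgeᵇ cut (nth φ a) (nth φ b) (nth φ c))) F32) → ⊥
      no-copy (φ , p ∷ q ∷ r ∷ s ∷ []) = exactlyOne-F32 (small (nth φ 0)) (small (nth φ 1)) (small (nth φ 2)) (small (nth φ 3)) (small (nth φ 4))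
        (cut⇒crosses _ _ _ p) (cut⇒crosses _ _ _ q) (cut⇒crosses _ _ _ r) (cut⇒crosses _ _ _ s)

    cut-edge : ∀ {a b c} → a ∷ b ∷ c ∷ [] ⊆ upTo n → small a ≡ true → small b ≡ false → small c ≡ false → edgeᵇ cut a b c ≡ true
    cut-edge {a} {b} {c} p sa sb sc = T⇒≡ (Equivalence.from T-∨ (inj₁ (∈⇒memᵇ
      (∈-filter⁺ (Bool.T? ∘ crosses) (∈-triples p) (subst T (sym crossing) _)))))
      where
      crossing : exactlyOne (small a) (small b) (small c) ≡ true
      crossing rewrite sa | sb | sc = refl

    cut-nonedge : ∀ {a b c} → small a ≡ false → small b ≡ false → small c ≡ false → edgeᵇ cut a b c ≡ false
    cut-nonedge {a} {b} {c} sa sb sc with edgeᵇ cut a b c in e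
    ... | false = refl
    ... | true  = ⊥-elim (subst T crossing (cut⇒crosses a b c (subst T (sym e) _)))
      where
      crossing : exactlyOne (small a) (small b) (small c) ≡ false
      crossing rewrite sa | sb | sc = refl

    -- In an increasing list the vertices of B come first, so a list has exactly one vertex in B
    -- precisely when only its head lies there.
    onlyFirst : List ℕ → Bool
    onlyFirst []      = false
    onlyFirst (x ∷ l) = small x ∧ all (not ∘ small) l

    onlyFirst-induces : ∀ {s} → s ⊆ upTo n → length s ≡ 4 → T (onlyFirst s) → inducesᵇ 4 K4⁻ cut s ≡ true
    onlyFirst-induces {a ∷ b ∷ c ∷ d ∷ []} p refl h with small a in sa | small b in sb | small c in sc | small d in sd
    ... | true | false | false | false = T⇒≡ (K4⁻-induces cut a b c d
      (cut-edge (⊆-trans (refl ∷ refl ∷ refl ∷ d ∷ʳ []) p) sa sb sc) (cut-edge (⊆-trans (refl ∷ refl ∷ c ∷ʳ refl ∷ []) p) sa sb sd)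
      (cut-edge (⊆-trans (refl ∷ b ∷ʳ refl ∷ refl ∷ []) p) sa sc sd) (cut-nonedge sb sc sd))

    choose-onlyFirst≤eH : choose 4 (upTo n) (λ l _ → ⟦ onlyFirst l ⟧) ℤ.≤ + eH 4 K4⁻ n cut
    choose-onlyFirst≤eH = subst (λ x → x ℤ.≤ + eH 4 K4⁻ n cut) (∑-kSublists 4 (upTo n) (λ l → ⟦ onlyFirst l ⟧))
      (∑≤length-filter (λ S → Bool._≟_ (inducesᵇ 4 K4⁻ cut S) true) (kSubsets 4 n) (λ l → ⟦⟧≤1 (onlyFirst l))
        (All.map (λ {s} (len , p) → missed s p len) both))
      where
      both : All (λ s → length s ≡ 4 × s ⊆ upTo n) (kSubsets 4 n)
      both = All.zip (Allₚ.all-filter _ (sublists (upTo n)) , Allₚ.filter⁺ (λ s → length s ℕₚ.≟ 4) (sublists-⊆ (upTo n)))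
      ⟦⟧≤1 : ∀ b → ⟦ b ⟧ ℤ.≤ 1ℤ
      ⟦⟧≤1 true  = ℤₚ.≤-refl
      ⟦⟧≤1 false = ℤ.+≤+ z≤n
      missed : ∀ s → s ⊆ upTo n → length s ≡ 4 → ¬ inducesᵇ 4 K4⁻ cut s ≡ true → ⟦ onlyFirst s ⟧ ℤ.≤ 0ℤ
      missed s p len h with onlyFirst s in e
      ... | false = ℤₚ.≤-refl
      ... | true  = ⊥-elim (h (onlyFirst-induces p len (subst T (sym e) _)))

  choose-nonneg : ∀ k (xs : List A) {f} → (∀ l r → 0ℤ ℤ.≤ f l r) → 0ℤ ℤ.≤ choose k xs f
  choose-nonneg zero    xs       h = h [] xs
  choose-nonneg (suc k) []       h = ℤₚ.≤-refl
  choose-nonneg (suc k) (x ∷ xs) h = ℤₚ.+-mono-≤ (choose-nonneg k xs (λ l → h (x ∷ l))) (choose-nonneg (suc k) xs (λ l r → h l (x ∷ r)))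

  C≤choose : {P : A → Set} (k : ℕ) {xs : List A} {f : List A → ℤ} → All P xs → (∀ {l} → All P l → 1ℤ ℤ.≤ f l) →
             + (length xs C k) ℤ.≤ choose k xs (λ l _ → f l)
  C≤choose zero    ps h = h []
  C≤choose (suc k) []       h = ℤₚ.≤-refl
  C≤choose (suc k) {x ∷ xs} {f} (p ∷ ps) h = subst (λ c → + c ℤ.≤ choose (suc k) (x ∷ xs) (λ l _ → f l))
    (nCk+nC[k+1]≡[n+1]C[k+1] (length xs) k)
    (ℤₚ.+-mono-≤ (C≤choose k ps (λ qs → h (p ∷ qs))) (C≤choose (suc k) ps h))

  choose-++ʳ : ∀ k (xs ys : List A) {f : List A → ℤ} → (∀ l → 0ℤ ℤ.≤ f l) → choose k ys (λ l _ → f l) ℤ.≤ choose k (xs ++ ys) (λ l _ → f l)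
  choose-++ʳ k       []       ys h = ℤₚ.≤-refl
  choose-++ʳ zero    (x ∷ xs) ys h = ℤₚ.≤-refl
  choose-++ʳ (suc k) (x ∷ xs) ys {f} h = ℤₚ.≤-trans (choose-++ʳ (suc k) xs ys h)
    (subst (λ z → z ℤ.≤ choose (suc k) (x ∷ xs ++ ys) (λ l _ → f l)) (ℤₚ.+-identityˡ _)
      (ℤₚ.+-monoˡ-≤ (choose (suc k) (xs ++ ys) (λ l _ → f l)) (choose-nonneg k (xs ++ ys) (λ l _ → h (x ∷ l)))))

  upTo-+ : ∀ (f : ℕ → ℕ) m j → applyUpTo f (m ℕ.+ j) ≡ applyUpTo f m ++ applyUpTo (λ i → f (m ℕ.+ i)) j
  upTo-+ f zero    j = refl
  upTo-+ f (suc m) j = cong (f 0 ∷_) (upTo-+ (f ∘ suc) m j)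

  module _ (m n : ℕ) where
    private
      f : List ℕ → ℤ
      f l = ⟦ onlyFirst m n l ⟧

      f-nonneg : ∀ l → 0ℤ ℤ.≤ f l
      f-nonneg l with onlyFirst m n l
      ... | true  = ℤ.+≤+ z≤n
      ... | false = ℤₚ.≤-refl

    -- The head `x` can be completed by any three entries of `ys`, which gives `length ys C 3`
    -- lists; those avoiding `x` are counted by induction.
    split-count : ∀ {xs ys} → All (λ x → small m n x ≡ true) xs → All (λ y → small m n y ≡ false) ys →
                  + (length xs ℕ.* (length ys C 3)) ℤ.≤ choose 4 (xs ++ ys) (λ l _ → f l)
    split-count {[]}     {ys} []       qs = choose-nonneg 4 ys (λ l _ → f-nonneg l)
    split-count {x ∷ xs} {ys} (p ∷ ps) qs = ℤₚ.+-mono-≤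
      (ℤₚ.≤-trans (C≤choose 3 qs first) (choose-++ʳ 3 xs ys (λ l → f-nonneg (x ∷ l))))
      (split-count ps qs)
      where
      large : ∀ {l} → All (λ y → small m n y ≡ false) l → all (not ∘ small m n) l ≡ true
      large []       = refl
      large (q ∷ qs) rewrite q = large qs
      first : ∀ {l} → All (λ y → small m n y ≡ false) l → 1ℤ ℤ.≤ f (x ∷ l)
      first qs rewrite p | large qs = ℤₚ.≤-refl

  foldr-⊔-upper : (c : ℕ) (f : A → ℕ) (b : ℕ) (xs : List A) → (∀ {x} → x ∈ xs → c ℕ.* f x ≤ b) → c ℕ.* foldr _⊔_ 0 (map f xs) ≤ b
  foldr-⊔-upper c f b []       h = ℕₚ.≤-trans (ℕₚ.≤-reflexive (ℕₚ.*-zeroʳ c)) z≤n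
  foldr-⊔-upper c f b (x ∷ xs) h = ℕₚ.≤-trans (ℕₚ.≤-reflexive (ℕₚ.*-distribˡ-⊔ c (f x) (foldr _⊔_ 0 (map f xs))))
    (ℕₚ.⊔-lub (h (here refl)) (foldr-⊔-upper c f b xs (h ∘ there)))

  ∈⇒≤foldr-⊔ : (f : A → ℕ) {xs : List A} {x : A} → x ∈ xs → f x ≤ foldr _⊔_ 0 (map f xs)
  ∈⇒≤foldr-⊔ f {y ∷ xs} (here refl) = ℕₚ.m≤m⊔n (f y) _
  ∈⇒≤foldr-⊔ f {y ∷ xs} (there p)   = ℕₚ.≤-trans (∈⇒≤foldr-⊔ f p) (ℕₚ.m≤n⊔m (f y) _)

  exH-lower : ∀ m j → m ℕ.* (j C 3) ≤ exH 4 K4⁻ ((5 , F32) ∷ []) (m ℕ.+ j)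
  exH-lower m j = ℕₚ.≤-trans (ℤₚ.drop‿+≤+ (ℤₚ.≤-trans counted (choose-onlyFirst≤eH m n)))
    (∈⇒≤foldr-⊔ (eH 4 K4⁻ n) (∈-filter⁺ (λ G → Bool._≟_ (freeᵇ ((5 , F32) ∷ []) n G) true) (cut∈allGraphs m n) (cut-free m n)))
    where
    n = m ℕ.+ j
    below : All (λ x → small m n x ≡ true) (upTo m)
    below = All.map (λ x<m → T⇒≡ (ℕₚ.<⇒<ᵇ x<m)) (Allₚ.all-upTo m)
    above : All (λ y → small m n y ≡ false) (applyUpTo (m ℕ.+_) j)
    above = Allₚ.applyUpTo⁺₂ (m ℕ.+_) j λ i → ≮ (ℕₚ.m≤m+n m i)
      where
      ≮ : ∀ {y} → m ≤ y → small m n y ≡ false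
      ≮ {y} m≤y with y <ᵇ m in e
      ... | false = refl
      ... | true  = ⊥-elim (ℕₚ.<⇒≱ (ℕₚ.<ᵇ⇒< y m (subst T (sym e) _)) m≤y)
    counted : + (m ℕ.* (j C 3)) ℤ.≤ choose 4 (upTo n) (λ l _ → ⟦ onlyFirst m n l ⟧)
    counted = subst₂ ℤ._≤_
      (cong₂ (λ a b → + (a ℕ.* (b C 3))) (length-applyUpTo id m) (length-applyUpTo (m ℕ.+_) j))
      (cong (λ xs → choose 4 xs (λ l _ → ⟦ onlyFirst m n l ⟧)) (sym (upTo-+ id m j)))
      (split-count m n below above)

-- Binomial coefficients and quartic estimates with cubic error.

module Arithmetic where
  open import Data.Nat
  open import Data.Nat.Properties
  open import Data.Nat.Combinatorics using (_C_; nCk+nC[k+1]≡[n+1]C[k+1]; nC1≡n)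
  open import Data.Nat.Tactic.RingSolver using (solve-∀)
  open import Relation.Binary.PropositionalEquality

  -- First of three falling factorial formulas, each obtained from the previous one by Pascal's
  -- rule. The upper index is shifted so that no truncated subtraction occurs.
  2*C2 : ∀ n → 2 * (suc n C 2) ≡ suc n * n
  2*C2 zero    = refl
  2*C2 (suc n) = begin
      2 * (suc (suc n) C 2)
    ≡⟨ cong (2 *_) (sym (nCk+nC[k+1]≡[n+1]C[k+1] (suc n) 1)) ⟩
      2 * (suc n C 1 + suc n C 2)
    ≡⟨ trans (*-distribˡ-+ 2 (suc n C 1) (suc n C 2)) (cong₂ (λ a b → 2 * a + b) (nC1≡n (suc n)) (2*C2 n)) ⟩
      2 * suc n + suc n * n
    ≡⟨ lemma n ⟩
      suc (suc n) * suc n ∎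
    where
    open ≡-Reasoning
    lemma : ∀ n → 2 * (1 + n) + (1 + n) * n ≡ (2 + n) * (1 + n)
    lemma = solve-∀

  6*C3 : ∀ n → 6 * (suc (suc n) C 3) ≡ suc (suc n) * (suc n * n)
  6*C3 zero    = refl
  6*C3 (suc n) = begin
      6 * (suc (suc (suc n)) C 3)
    ≡⟨ cong (6 *_) (sym (nCk+nC[k+1]≡[n+1]C[k+1] (suc (suc n)) 2)) ⟩
      6 * (suc (suc n) C 2 + suc (suc n) C 3)
    ≡⟨ lemma₁ (suc (suc n) C 2) (suc (suc n) C 3) ⟩
      3 * (2 * (suc (suc n) C 2)) + 6 * (suc (suc n) C 3)
    ≡⟨ cong₂ (λ a b → 3 * a + b) (2*C2 (suc n)) (6*C3 n) ⟩
      3 * (suc (suc n) * suc n) + suc (suc n) * (suc n * n)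
    ≡⟨ lemma₂ n ⟩
      suc (suc (suc n)) * (suc (suc n) * suc n) ∎
    where
    open ≡-Reasoning
    lemma₁ : ∀ a b → 6 * (a + b) ≡ 3 * (2 * a) + 6 * b
    lemma₁ = solve-∀
    lemma₂ : ∀ n → 3 * ((2 + n) * (1 + n)) + (2 + n) * ((1 + n) * n) ≡ (3 + n) * ((2 + n) * (1 + n))
    lemma₂ = solve-∀

  24*C4 : ∀ n → 24 * ((3 + n) C 4) ≡ (3 + n) * ((2 + n) * ((1 + n) * n))
  24*C4 zero    = refl
  24*C4 (suc n) = begin
      24 * ((4 + n) C 4)
    ≡⟨ cong (24 *_) (sym (nCk+nC[k+1]≡[n+1]C[k+1] (3 + n) 3)) ⟩
      24 * ((3 + n) C 3 + ((3 + n) C 4))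
    ≡⟨ lemma₁ ((3 + n) C 3) ((3 + n) C 4) ⟩
      4 * (6 * ((3 + n) C 3)) + 24 * ((3 + n) C 4)
    ≡⟨ cong₂ (λ a b → 4 * a + b) (6*C3 (suc n)) (24*C4 n) ⟩
      4 * ((3 + n) * ((2 + n) * (1 + n))) + (3 + n) * ((2 + n) * ((1 + n) * n))
    ≡⟨ lemma₂ n ⟩
      (4 + n) * ((3 + n) * ((2 + n) * (1 + n))) ∎
    where
    open ≡-Reasoning
    lemma₁ : ∀ a b → 24 * (a + b) ≡ 4 * (6 * a) + 24 * b
    lemma₁ = solve-∀
    lemma₂ : ∀ n → 4 * ((3 + n) * ((2 + n) * (1 + n))) + (3 + n) * ((2 + n) * ((1 + n) * n)) ≡ (4 + n) * ((3 + n) * ((2 + n) * (1 + n)))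
    lemma₂ = solve-∀

  *-mono₃ : ∀ {a b c x y z} → a ≤ x → b ≤ y → c ≤ z → a * (b * c) ≤ x * (y * z)
  *-mono₃ p q r = *-mono-≤ p (*-mono-≤ q r)

  ^4-expand : ∀ n → n ^ 4 ≡ n * (n * (n * n))
  ^4-expand n = cong (λ x → n * (n * (n * x))) (*-identityʳ n)

  ^3-expand : ∀ n → n ^ 3 ≡ n * (n * n)
  ^3-expand n = cong (λ x → n * (n * x)) (*-identityʳ n)

  -- With n = c + q, the difference n⁴ - q⁴ is c(n³ + qn² + q²n + q³), and each of the four summands
  -- is at most n³.
  shifted-^4 : ∀ c q → (c + q) ^ 4 ≤ q ^ 4 + 4 * c * (c + q) ^ 3
  shifted-^4 c q = begin
      n ^ 4
    ≡⟨ trans (^4-expand n) (lemma₁ c q) ⟩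
      q * (q * (q * q)) + c * (n * (n * n) + q * (n * n) + q * (q * n) + q * (q * q))
    ≤⟨ +-monoʳ-≤ (q * (q * (q * q))) (*-monoʳ-≤ c
         (+-mono-≤ (+-mono-≤ (+-mono-≤ (≤-refl {N}) (*-mono₃ q≤n (≤-refl {n}) (≤-refl {n}))) (*-mono₃ q≤n q≤n (≤-refl {n}))) (*-mono₃ q≤n q≤n q≤n))) ⟩
      q * (q * (q * q)) + c * (N + N + N + N)
    ≡⟨ cong₂ _+_ (sym (^4-expand q)) (trans (lemma₂ c N) (cong (4 * c *_) (sym (^3-expand n)))) ⟩
      q ^ 4 + 4 * c * n ^ 3 ∎
    where
    open ≤-Reasoning
    n = c + q
    N = n * (n * n)
    q≤n : q ≤ n
    q≤n = m≤n+m q c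
    lemma₁ : ∀ c q → (c + q) * ((c + q) * ((c + q) * (c + q))) ≡ q * (q * (q * q)) +
             c * ((c + q) * ((c + q) * (c + q)) + q * ((c + q) * (c + q)) + q * (q * (c + q)) + q * (q * q))
    lemma₁ = solve-∀
    lemma₂ : ∀ c N → c * (N + N + N + N) ≡ 4 * c * N
    lemma₂ = solve-∀

  24*C4≤n^4 : ∀ n → 24 * (n C 4) ≤ n ^ 4
  24*C4≤n^4 0 = z≤n
  24*C4≤n^4 1 = z≤n
  24*C4≤n^4 2 = z≤n
  24*C4≤n^4 (suc (suc (suc i))) = ≤-trans (≤-reflexive (24*C4 i)) (≤-trans
    (*-mono-≤ (≤-refl {3 + i}) (*-mono₃ (m≤n+m (2 + i) 1) (m≤n+m (1 + i) 2) (m≤n+m i 3))) (≤-reflexive (sym (^4-expand (3 + i)))))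

  -- 24 · C(n,4) is a product of four factors, each at least n - 3, so `shifted-^4` with shift 3
  -- leaves the error 4 · 3 · n³.
  n^4≤24*C4 : ∀ n → 3 ≤ n → n ^ 4 ≤ 24 * (n C 4) + 12 * n ^ 3
  n^4≤24*C4 (suc zero) (s≤s ())
  n^4≤24*C4 (suc (suc zero)) (s≤s (s≤s ()))
  n^4≤24*C4 (suc (suc (suc i))) _ = ≤-trans (shifted-^4 3 i) (+-monoˡ-≤ (12 * (3 + i) ^ 3)
    (≤-trans (≤-reflexive (^4-expand i)) (≤-trans (*-mono-≤ (m≤n+m i 3) (*-mono₃ (m≤n+m i 2) (m≤n+m i 1) (≤-refl {i})))
      (≤-reflexive (sym (24*C4 i))))))

  ≤-scaled : ∀ {a b c x y z w} → x ≤ y + b * z → a * y ≤ w → a * b ≡ c → a * x ≤ w + c * z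
  ≤-scaled {a} {b} {c} {x} {y} {z} {w} h k refl = begin
      a * x               ≤⟨ *-monoʳ-≤ a h ⟩
      a * (y + b * z)     ≡⟨ trans (*-distribˡ-+ a y (b * z)) (cong (a * y +_) (sym (*-assoc a b z))) ⟩
      a * y + a * b * z   ≤⟨ +-monoˡ-≤ (a * b * z) k ⟩
      w + a * b * z       ∎
    where open ≤-Reasoning

  -- 27q⁴ = q(3q)³ is at most 4m(4p)³ = 256mp³, and p³ is at most 6 · C(p + 2, 3); this makes 1536 =
  -- 256 · 6.
  cut-count : ∀ {q m p} → q ≤ 4 * m → 3 * q ≤ 4 * p → 27 * q ^ 4 ≤ 1536 * (m * ((2 + p) C 3))
  cut-count {q} {m} {p} q≤4m 3q≤4p = begin
      27 * q ^ 4
    ≡⟨ trans (cong (27 *_) (^4-expand q)) (lemma₁ q) ⟩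
      q * (3 * q * (3 * q * (3 * q)))
    ≤⟨ *-mono-≤ q≤4m (*-mono₃ 3q≤4p 3q≤4p 3q≤4p) ⟩
      4 * m * (4 * p * (4 * p * (4 * p)))
    ≡⟨ lemma₂ m p ⟩
      256 * (m * (p * (p * p)))
    ≤⟨ *-monoʳ-≤ 256 (*-monoʳ-≤ m falling) ⟩
      256 * (m * (6 * c))
    ≡⟨ collect {256} {6} {1536} m c refl ⟩
      1536 * (m * c) ∎
    where
    open ≤-Reasoning
    c = (2 + p) C 3
    falling : p * (p * p) ≤ 6 * c
    falling = subst (p * (p * p) ≤_) (sym (6*C3 p)) (*-mono₃ (m≤n+m p 2) (m≤n+m p 1) (≤-refl {p}))
    lemma₁ : ∀ q → 27 * (q * (q * (q * q))) ≡ q * (3 * q * (3 * q * (3 * q)))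
    lemma₁ = solve-∀
    lemma₂ : ∀ m p → 4 * m * (4 * p * (4 * p * (4 * p))) ≡ 256 * (m * (p * (p * p)))
    lemma₂ = solve-∀
    lemma₃ : ∀ a b m c → a * (m * (b * c)) ≡ a * b * (m * c)
    lemma₃ = solve-∀
    collect : ∀ {a b d} m c → a * b ≡ d → a * (m * (b * c)) ≡ d * (m * c)
    collect {a} {b} m c refl = lemma₃ a b m c

  -- With q = n − 6, the parts of the cut satisfy 4m ≥ q and 4(n − m − 2) ≥ 3q.
  cut-size : ∀ {n m} → 8 ≤ n → m * 4 ≤ n → n ≤ 3 + m * 4 → 27 * n ^ 4 ≤ 1536 * (m * ((n ∸ m) C 3)) + 648 * n ^ 3
  cut-size {n} {m} 8≤n 4m≤n n≤3+4m = ≤-scaled {27} {24} {648} {n ^ 4} {q ^ 4} {n ^ 3} (subst (λ x → x ^ 4 ≤ q ^ 4 + 24 * x ^ 3) 6+q≡n (shifted-^4 6 q))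
    (subst (λ j → 27 * q ^ 4 ≤ 1536 * (m * (j C 3))) 2+p≡n∸m (cut-count {q} {m} {p} q≤4m 3q≤4p)) refl
    where
    open ≤-Reasoning
    q = n ∸ 6
    p = n ∸ m ∸ 2
    6+q≡n : 6 + q ≡ n
    6+q≡n = m+[n∸m]≡n (≤-trans (m≤n+m 6 2) 8≤n)
    m≤n : m ≤ n
    m≤n = ≤-trans (m≤m*n m 4) 4m≤n
    2≤n∸m : 2 ≤ n ∸ m
    2≤n∸m = *-cancelˡ-≤ 4 (begin
        8
      ≤⟨ 8≤n ⟩
        n
      ≤⟨ m≤m+n n (2 * n) ⟩
        3 * n
      ≡⟨ sym (m+n∸n≡m (3 * n) n) ⟩
        3 * n + n ∸ n
      ≤⟨ ∸-monoʳ-≤ (3 * n + n) 4m≤n ⟩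
        3 * n + n ∸ m * 4
      ≡⟨ cong₂ _∸_ (lemma₄ n) (*-comm m 4) ⟩
        4 * n ∸ 4 * m
      ≡⟨ sym (*-distribˡ-∸ 4 n m) ⟩
        4 * (n ∸ m) ∎)
      where
      lemma₄ : ∀ n → 3 * n + n ≡ 4 * n
      lemma₄ = solve-∀
    2+p≡n∸m : 2 + p ≡ n ∸ m
    2+p≡n∸m = m+[n∸m]≡n 2≤n∸m
    m+2+p≡n : m + (2 + p) ≡ n
    m+2+p≡n = trans (cong (m +_) 2+p≡n∸m) (m+[n∸m]≡n m≤n)
    q≤4m : q ≤ 4 * m
    q≤4m = +-cancelˡ-≤ 6 _ _ (≤-trans (≤-reflexive 6+q≡n) (≤-trans n≤3+4m (+-mono-≤ (m≤m+n 3 3) (≤-reflexive (*-comm m 4)))))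
    3q≤4p : 3 * q ≤ 4 * p
    3q≤4p = +-cancelˡ-≤ (18 + m * 4) _ _ (begin
        18 + m * 4 + 3 * q
      ≡⟨ lemma₅ m q ⟩
        m * 4 + 3 * (6 + q)
      ≤⟨ +-monoˡ-≤ (3 * (6 + q)) 4m≤n ⟩
        n + 3 * (6 + q)
      ≡⟨ cong (λ x → n + 3 * x) 6+q≡n ⟩
        4 * n
      ≡⟨ cong (4 *_) (sym m+2+p≡n) ⟩
        4 * (m + (2 + p))
      ≡⟨ lemma₆ m p ⟩
        8 + m * 4 + 4 * p
      ≤⟨ +-monoˡ-≤ (4 * p) (+-monoˡ-≤ (m * 4) (m≤m+n 8 10)) ⟩
        18 + m * 4 + 4 * p ∎)
      where
      lemma₅ : ∀ m q → 18 + m * 4 + 3 * q ≡ m * 4 + 3 * (6 + q)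
      lemma₅ = solve-∀
      lemma₆ : ∀ m p → 4 * (m + (2 + p)) ≡ 8 + m * 4 + 4 * p
      lemma₆ = solve-∀

  -- Comparison of 64a with 27c, where `N₃`, `N₄` and `c` stand for n³, n⁴ and C(n,4).

  module _ (q a c N₃ N₄ : ℕ) (24qN₃≤N₄ : 24 * (q * N₃) ≤ N₄) (24N₃≤N₄ : 24 * N₃ ≤ N₄)
           (upper : 1536 * a ≤ 27 * N₄) (lower : 27 * N₄ ≤ 1536 * a + 648 * N₃)
           (24c≤N₄ : 24 * c ≤ N₄) (N₄≤ : N₄ ≤ 24 * c + 12 * N₃) where
    open ≤-Reasoning

    -- Adding the upper bound for `N₄` to itself makes the error 24 · `N₃`, which one copy of `N₄`
    -- absorbs.
    N₄≤48c : N₄ ≤ 48 * c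
    N₄≤48c = +-cancelʳ-≤ N₄ N₄ (48 * c) (begin
        N₄ + N₄                        ≤⟨ +-mono-≤ N₄≤ N₄≤ ⟩
        24 * c + 12 * N₃ + (24 * c + 12 * N₃) ≡⟨ lemma c N₃ ⟩
        48 * c + 24 * N₃           ≤⟨ +-monoʳ-≤ (48 * c) 24N₃≤N₄ ⟩
        48 * c + N₄                  ∎)
      where
      lemma : ∀ c n → 24 * c + 12 * n + (24 * c + 12 * n) ≡ 48 * c + 24 * n
      lemma = solve-∀

    -- 27 · 48 = 1296 < 1536 = 24 · 64
    slack : 27 * N₄ ≤ 24 * (64 * c)
    slack = begin
        27 * N₄              ≤⟨ *-monoʳ-≤ 27 N₄≤48c ⟩
        27 * (48 * c)      ≡⟨ sym (*-assoc 27 48 c) ⟩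
        1296 * c             ≤⟨ *-monoˡ-≤ c (m≤m+n 1296 240) ⟩
        1536 * c             ≡⟨ *-assoc 24 64 c ⟩
        24 * (64 * c)      ∎

    -- After multiplying by 24 the error is 27 · 12 · `q * N₃`, which is at most 27 · `N₄` and so
    -- falls under `slack`.
    above : q * (64 * a) ≤ q * (27 * c) + 64 * c
    above = *-cancelˡ-≤ 24 (begin
        24 * (q * (64 * a))
      ≡⟨ trans (swap 24 q (64 * a)) (cong (q *_) (sym (*-assoc 24 64 a))) ⟩
        q * (1536 * a)
      ≤⟨ *-monoʳ-≤ q upper ⟩
        q * (27 * N₄)
      ≤⟨ *-monoʳ-≤ q (*-monoʳ-≤ 27 N₄≤) ⟩
        q * (27 * (24 * c + 12 * N₃))
      ≡⟨ expand q c N₃ ⟩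
        24 * (q * (27 * c)) + 27 * (12 * (q * N₃))
      ≤⟨ +-monoʳ-≤ (24 * (q * (27 * c))) (≤-trans (*-monoʳ-≤ 27
           (≤-trans (*-monoˡ-≤ (q * N₃) (m≤m+n 12 12)) 24qN₃≤N₄)) slack) ⟩
        24 * (q * (27 * c)) + 24 * (64 * c)
      ≡⟨ sym (*-distribˡ-+ 24 (q * (27 * c)) (64 * c)) ⟩
        24 * (q * (27 * c) + 64 * c) ∎)
      where
      swap : ∀ x y z → x * (y * z) ≡ y * (x * z)
      swap = solve-∀
      expand : ∀ q c n → q * (27 * (24 * c + 12 * n)) ≡ 24 * (q * (27 * c)) + 27 * (12 * (q * n))
      expand = solve-∀

    -- Here 648 = 27 · 24, so the error is 27 · (24 · `q * N₃`), again at most 27 · `N₄`.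
    below : q * (27 * c) ≤ q * (64 * a) + 64 * c
    below = *-cancelˡ-≤ 24 (begin
        24 * (q * (27 * c))
      ≡⟨ swap 24 q 27 c ⟩
        q * (27 * (24 * c))
      ≤⟨ *-monoʳ-≤ q (≤-trans (*-monoʳ-≤ 27 24c≤N₄) lower) ⟩
        q * (1536 * a + 648 * N₃)
      ≡⟨ collect {24} {64} {27} {24} {1536} {648} refl refl ⟩
        24 * (q * (64 * a)) + 27 * (24 * (q * N₃))
      ≤⟨ +-monoʳ-≤ (24 * (q * (64 * a))) (≤-trans (*-monoʳ-≤ 27 24qN₃≤N₄) slack) ⟩
        24 * (q * (64 * a)) + 24 * (64 * c)
      ≡⟨ sym (*-distribˡ-+ 24 (q * (64 * a)) (64 * c)) ⟩
        24 * (q * (64 * a) + 64 * c) ∎)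
      where
      swap : ∀ x y z w → x * (y * (z * w)) ≡ y * (z * (x * w))
      swap = solve-∀
      expand : ∀ u v x y q a n → q * (u * v * a + x * y * n) ≡ u * (q * (v * a)) + x * (y * (q * n))
      expand = solve-∀
      collect : ∀ {u v x y s t} → u * v ≡ s → x * y ≡ t →
                q * (s * a + t * N₃) ≡ u * (q * (v * a)) + x * (y * (q * N₃))
      collect {u} {v} {x} {y} refl refl = expand u v x y q a N₃

-- Passage from integer inequalities to the rational limit.

module Limit where
  open import Defs
  open Search
  open UpperBound
  open LowerBound
  open Arithmetic
  open import Data.Nat as ℕ using (ℕ; suc; _≥_; z≤n; s≤s)
  import Data.Nat.Properties as ℕₚ
  open import Data.Nat.Combinatorics using (_C_)
  open import Data.Nat.DivMod as DivMod using (m≡m%n+[m/n]*n; m%n<n)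
  open import Data.Integer as ℤ using (ℤ; +_)
  open import Data.Integer.Properties as ℤₚ using ()
  open import Data.Integer.Tactic.RingSolver using (solve-∀)
  open import Data.List using (_∷_; [])
  open import Data.List.Membership.Propositional.Properties using (∈-filter⁻)
  open import Data.Nat.Coprimality using (Coprime)
  open import Data.Product using (_,_; proj₂)
  open import Data.Sum using (inj₁; inj₂)
  open import Data.Rational using (ℚ; mkℚ; _/_; _≤_; _-_; _*_; ∣_∣; toℚᵘ)
  import Data.Rational as ℚ
  import Data.Rational.Properties as ℚₚ
  open import Data.Rational.Unnormalised as ℚᵘ using (ℚᵘ; mkℚᵘ; *≤*)
  import Data.Rational.Unnormalised.Properties as ℚᵘₚ
  open import Relation.Binary.PropositionalEquality
  import Data.Bool as Bool
  open import Data.Bool using (true)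

  ex : ℕ → ℕ
  ex = exH 4 K4⁻ ((5 , F32) ∷ [])

  -- The cut is taken with B of size n / 4, rounded down. The error 648 = 27 · 4 · 6 comes from
  -- replacing n by n - 6 in the fourth power, which absorbs the rounding.
  ex-lower : ∀ n → n ≥ 8 → 27 ℕ.* n ℕ.^ 4 ℕ.≤ 1536 ℕ.* ex n ℕ.+ 648 ℕ.* n ℕ.^ 3
  ex-lower n 8≤n = ℕₚ.≤-trans (cut-size {n} {m} 8≤n 4m≤n n≤3+4m) (ℕₚ.+-monoˡ-≤ (648 ℕ.* n ℕ.^ 3) (ℕₚ.*-monoʳ-≤ 1536
      (subst (λ k → m ℕ.* ((n ℕ.∸ m) C 3) ℕ.≤ ex k) (ℕₚ.m+[n∸m]≡n (ℕₚ.≤-trans (ℕₚ.m≤m*n m 4) 4m≤n)) (exH-lower m (n ℕ.∸ m)))))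
    where
    m : ℕ
    m = n DivMod./ 4
    4m≤n : m ℕ.* 4 ℕ.≤ n
    4m≤n = ℕₚ.≤-trans (ℕₚ.m≤n+m (m ℕ.* 4) (n DivMod.% 4)) (ℕₚ.≤-reflexive (sym (m≡m%n+[m/n]*n n 4)))
    n≤3+4m : n ℕ.≤ 3 ℕ.+ m ℕ.* 4
    n≤3+4m = ℕₚ.≤-trans (ℕₚ.≤-reflexive (m≡m%n+[m/n]*n n 4)) (ℕₚ.+-monoˡ-≤ (m ℕ.* 4) (ℕ.s≤s⁻¹ (m%n<n n 4)))

  -- The conclusion has the cross-multiplied shape of an inequality between unnormalised fractions;
  -- the sign of A - B decides which one-sided bound is used.
  cross-multiplied : ∀ {N A B Q C D : ℤ} → N ≡ A ℤ.- B → Q ℤ.* A ℤ.≤ Q ℤ.* B ℤ.+ C → Q ℤ.* B ℤ.≤ Q ℤ.* A ℤ.+ C → C ℤ.≤ D →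
                     + ℤ.∣ N ∣ ℤ.* Q ℤ.≤ D
  cross-multiplied {A = A} {B} {Q} {C} {D} refl above below C≤D with ℤₚ.+∣i∣≡i⊎+∣i∣≡-i (A ℤ.- B)
  ... | inj₁ e = subst (λ x → x ℤ.* Q ℤ.≤ D) (sym e) (begin
        (A ℤ.- B) ℤ.* Q               ≡⟨ lemma₁ A B Q ⟩
        Q ℤ.* A ℤ.- Q ℤ.* B           ≤⟨ ℤₚ.+-monoˡ-≤ (ℤ.- (Q ℤ.* B)) above ⟩
        Q ℤ.* B ℤ.+ C ℤ.- Q ℤ.* B     ≡⟨ lemma₂ (Q ℤ.* B) C ⟩
        C                             ≤⟨ C≤D ⟩
        D                             ∎)
    where
    open ℤₚ.≤-Reasoning
    lemma₁ : ∀ a b q → (a ℤ.- b) ℤ.* q ≡ q ℤ.* a ℤ.- q ℤ.* b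
    lemma₁ = solve-∀
    lemma₂ : ∀ b c → b ℤ.+ c ℤ.- b ≡ c
    lemma₂ = solve-∀
  ... | inj₂ e = subst (λ x → x ℤ.* Q ℤ.≤ D) (sym e) (begin
        ℤ.- (A ℤ.- B) ℤ.* Q           ≡⟨ lemma₁ A B Q ⟩
        Q ℤ.* B ℤ.- Q ℤ.* A           ≤⟨ ℤₚ.+-monoˡ-≤ (ℤ.- (Q ℤ.* A)) below ⟩
        Q ℤ.* A ℤ.+ C ℤ.- Q ℤ.* A     ≡⟨ lemma₂ (Q ℤ.* A) C ⟩
        C                             ≤⟨ C≤D ⟩
        D                             ∎)
    where
    open ℤₚ.≤-Reasoning
    lemma₁ : ∀ a b q → ℤ.- (a ℤ.- b) ℤ.* q ≡ q ℤ.* b ℤ.- q ℤ.* a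
    lemma₁ = solve-∀
    lemma₂ : ∀ b c → b ℤ.+ c ℤ.- b ≡ c
    lemma₂ = solve-∀

  -- A positive ε with denominator d + 1 is at least 1 / (d + 1), so an error of c / (d + 1) is
  -- allowed. Multiplying by 64(d + 1) gives the two integer hypotheses. The comparison is made on
  -- unnormalised fractions, whose numerators and denominators are explicit.
  rational-bound : ∀ a c p d .(coprime : Coprime (suc p) (suc d)) → suc d ℕ.* (64 ℕ.* a) ℕ.≤ suc d ℕ.* (27 ℕ.* c) ℕ.+ 64 ℕ.* c →
                   suc d ℕ.* (27 ℕ.* c) ℕ.≤ suc d ℕ.* (64 ℕ.* a) ℕ.+ 64 ℕ.* c →
                   ∣ (+ a) / 1 - (+ 27 / 64) * ((+ c) / 1) ∣ ≤ mkℚ (+ suc p) d coprime * ((+ c) / 1)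
  rational-bound a c p d coprime above below = ℚₚ.toℚᵘ-cancel-≤ (begin
      toℚᵘ ∣ (+ a) / 1 - (+ 27 / 64) * ((+ c) / 1) ∣
    ≃⟨ ℚᵘₚ.≃-trans (ℚₚ.toℚᵘ-homo-∣-∣ ((+ a) / 1 - (+ 27 / 64) * ((+ c) / 1))) (ℚᵘₚ.∣-∣-cong difference) ⟩
      ℚᵘ.∣ mkℚᵘ (+ a) 0 ℚᵘ.- mkℚᵘ (+ 27) 63 ℚᵘ.* mkℚᵘ (+ c) 0 ∣
    ≤⟨ *≤* (cross-multiplied numerator above′ below′ enough) ⟩
      mkℚᵘ (+ suc p) d ℚᵘ.* mkℚᵘ (+ c) 0
    ≃⟨ ℚᵘₚ.≃-sym (ℚᵘₚ.≃-trans (ℚₚ.toℚᵘ-homo-* (mkℚ (+ suc p) d coprime) ((+ c) / 1)) (ℚᵘₚ.*-congˡ {mkℚᵘ (+ suc p) d} (toℚᵘ-/ (+ c) 0))) ⟩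
      toℚᵘ (mkℚ (+ suc p) d coprime * ((+ c) / 1)) ∎)
    where
    open ℚᵘₚ.≤-Reasoning
    toℚᵘ-/ : ∀ i k → toℚᵘ (i / suc k) ℚᵘ.≃ mkℚᵘ i k
    toℚᵘ-/ i k = ℚₚ.toℚᵘ-fromℚᵘ (mkℚᵘ i k)
    difference : toℚᵘ ((+ a) / 1 - (+ 27 / 64) * ((+ c) / 1)) ℚᵘ.≃ mkℚᵘ (+ a) 0 ℚᵘ.- mkℚᵘ (+ 27) 63 ℚᵘ.* mkℚᵘ (+ c) 0
    difference = ℚᵘₚ.≃-trans (ℚₚ.toℚᵘ-homo-+ ((+ a) / 1) (ℚ.- ((+ 27 / 64) * ((+ c) / 1)))) (ℚᵘₚ.+-cong (toℚᵘ-/ (+ a) 0)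
      (ℚᵘₚ.≃-trans (ℚₚ.toℚᵘ-homo‿- ((+ 27 / 64) * ((+ c) / 1))) (ℚᵘₚ.-‿cong
        (ℚᵘₚ.≃-trans (ℚₚ.toℚᵘ-homo-* (+ 27 / 64) ((+ c) / 1)) (ℚᵘₚ.*-cong (toℚᵘ-/ (+ 27) 63) (toℚᵘ-/ (+ c) 0))))))
    U V : ℚᵘ
    U = mkℚᵘ (+ a) 0 ℚᵘ.- mkℚᵘ (+ 27) 63 ℚᵘ.* mkℚᵘ (+ c) 0
    V = mkℚᵘ (+ suc p) d ℚᵘ.* mkℚᵘ (+ c) 0
    lift : ∀ q x y z → q ℕ.* x ℕ.≤ q ℕ.* y ℕ.+ z → + q ℤ.* + x ℤ.≤ + q ℤ.* + y ℤ.+ + z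
    lift q x y z h = subst₂ ℤ._≤_ (ℤₚ.pos-* q x) (cong (λ i → i ℤ.+ + z) (ℤₚ.pos-* q y)) (ℤ.+≤+ h)
    numerator : ℚᵘ.↥ U ≡ + (64 ℕ.* a) ℤ.- + (27 ℕ.* c)
    numerator = trans (rearrange (+ a) (+ c) (+ 64) (+ 27)) (cong₂ ℤ._-_ (sym (ℤₚ.pos-* 64 a)) (sym (ℤₚ.pos-* 27 c)))
      where
      rearrange : ∀ a c u v → a ℤ.* u ℤ.+ ℤ.- (v ℤ.* c) ℤ.* + 1 ≡ u ℤ.* a ℤ.- v ℤ.* c
      rearrange = solve-∀
    denominator : + suc d ≡ ℚᵘ.↧ V
    denominator = cong (λ x → + suc x) (sym (ℕₚ.*-identityʳ d))
    above′ : ℚᵘ.↧ V ℤ.* + (64 ℕ.* a) ℤ.≤ ℚᵘ.↧ V ℤ.* + (27 ℕ.* c) ℤ.+ + (64 ℕ.* c)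
    above′ = subst (λ q → q ℤ.* + (64 ℕ.* a) ℤ.≤ q ℤ.* + (27 ℕ.* c) ℤ.+ + (64 ℕ.* c)) denominator
      (lift (suc d) (64 ℕ.* a) (27 ℕ.* c) (64 ℕ.* c) above)
    below′ : ℚᵘ.↧ V ℤ.* + (27 ℕ.* c) ℤ.≤ ℚᵘ.↧ V ℤ.* + (64 ℕ.* a) ℤ.+ + (64 ℕ.* c)
    below′ = subst (λ q → q ℤ.* + (27 ℕ.* c) ℤ.≤ q ℤ.* + (64 ℕ.* a) ℤ.+ + (64 ℕ.* c)) denominator
      (lift (suc d) (27 ℕ.* c) (64 ℕ.* a) (64 ℕ.* c) below)
    enough : + (64 ℕ.* c) ℤ.≤ ℚᵘ.↥ V ℤ.* ℚᵘ.↧ U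
    enough = subst (λ x → + (64 ℕ.* c) ℤ.≤ x)
      (trans (ℤₚ.pos-* (suc p ℕ.* c) 64) (cong (λ i → i ℤ.* + 64) (ℤₚ.pos-* (suc p) c)))
      (ℤ.+≤+ (ℕₚ.≤-trans (ℕₚ.≤-reflexive (ℕₚ.*-comm 64 c)) (ℕₚ.*-monoˡ-≤ 64 (ℕₚ.m≤n*m c (suc p)))))

  ex-upper : ∀ n .{{_ : ℕ.NonZero n}} → 1536 ℕ.* ex n ℕ.≤ 27 ℕ.* n ℕ.^ 4
  ex-upper n = foldr-⊔-upper 1536 (eH 4 K4⁻ n) (27 ℕ.* n ℕ.^ 4) _ λ {G} p → eH-bound n G
    (proj₂ (∈-filter⁻ (λ G → Bool._≟_ (freeᵇ ((5 , F32) ∷ []) n G) true) {xs = allGraphs n} p))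

  -- The threshold 24(d + 1) is what makes 24(d + 1)n³ at most n⁴, so that the cubic errors are a 1
  -- / (d + 1) fraction of the main term.
  approximation : ∀ p d .(coprime : Coprime (suc p) (suc d)) n → n ≥ 24 ℕ.* suc d →
    ∣ (+ ex n) / 1 - (+ 27 / 64) * ((+ (n C 4)) / 1) ∣ ≤ mkℚ (+ suc p) d coprime * ((+ (n C 4)) / 1)
  approximation p d coprime n n≥ = rational-bound (ex n) (n C 4) p d coprime
    (above (suc d) (ex n) (n C 4) (n ℕ.^ 3) (n ℕ.^ 4) h₁ h₂ h₃ h₄ h₅ h₆)
    (below (suc d) (ex n) (n C 4) (n ℕ.^ 3) (n ℕ.^ 4) h₁ h₂ h₃ h₄ h₅ h₆)
    where
    24≤n : 24 ℕ.≤ n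
    24≤n = ℕₚ.≤-trans (ℕₚ.m≤m*n 24 (suc d)) n≥
    instance
      n≢0 : ℕ.NonZero n
      n≢0 = ℕ.>-nonZero (ℕₚ.≤-trans (s≤s z≤n) 24≤n)
    h₁ : 24 ℕ.* (suc d ℕ.* n ℕ.^ 3) ℕ.≤ n ℕ.^ 4
    h₁ = ℕₚ.≤-trans (ℕₚ.≤-reflexive (sym (ℕₚ.*-assoc 24 (suc d) (n ℕ.^ 3)))) (ℕₚ.*-monoˡ-≤ (n ℕ.^ 3) n≥)
    h₂ : 24 ℕ.* n ℕ.^ 3 ℕ.≤ n ℕ.^ 4
    h₂ = ℕₚ.*-monoˡ-≤ (n ℕ.^ 3) 24≤n
    h₃ = ex-upper n
    h₄ = ex-lower n (ℕₚ.≤-trans (ℕₚ.m≤m+n 8 16) 24≤n)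
    h₅ = 24*C4≤n^4 n
    h₆ = n^4≤24*C4 n (ℕₚ.≤-trans (ℕₚ.m≤m+n 3 21) 24≤n)

-- The density statement in epsilon form.

open import Defs
open import Data.Nat using (ℕ; _≥_)
open import Data.Nat.Combinatorics using (_C_)
open import Data.Product using (∃; _,_; _×_)
open import Data.List using (_∷_; [])
open import Data.Integer using (+_)
open import Data.Rational using (ℚ; _/_; _<_; _≤_; _-_; _*_; ∣_∣; 0ℚ)
open import Data.Rational using (mkℚ; *<*)
open import Data.Integer using (-[1+_]; +<+)
open import Data.Nat using (zero; suc)

theorem2p22 : (ε : ℚ) → 0ℚ < ε → ∃ λ (N : ℕ) → (n : ℕ) → n ≥ N →
    ∣ (+ exH 4 K4⁻ ((5 , F32) ∷ []) n) / 1 - (+ 27 / 64) * ((+ (n C 4)) / 1) ∣ ≤ ε * ((+ (n C 4)) / 1)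
theorem2p22 (mkℚ (+ suc p) d coprime) 0<ε = 24 Data.Nat.* suc d , Limit.approximation p d coprime
theorem2p22 (mkℚ (+ zero) d coprime)  (*<* (+<+ ()))
theorem2p22 (mkℚ -[1+ _ ] d coprime) (*<* ())
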